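{- Let $q$ be a prime power and $m,k,n$ positive integers with $k\le n$. Let $\mathcal{C}$ be a nondegenerate $[n,k]_{q^m/q}$ code and let $\mathcal{U}$ be an $[n,k]_{q^m/q}$ system associated with $\mathcal{C}$. Let $h,r$ be integers with $0\le h<k$ and $h\le r\le n-k+h-1$. Then the following are equivalent: (1) $\mathcal{U}$ is $(h,r)$-evasive; (2) $d_{\mathrm{rk},k-h}(\mathcal{C})\ge n-r$; (3) $d_{\mathrm{rk},r-h+1}(\mathcal{C}^\perp)\ge r+2$. Moreover, $d_{\mathrm{rk},k-h}(\mathcal{C})=n-r$ if and only if $\mathcal{U}$ is $(h,r)$-evasive but not $(h,r-1)$-evasive, if and only if $d_{\mathrm{rk},r-h+1}(\mathcal{C}^\perp)\ge r+2\ge d_{\mathrm{rk},r-h}(\mathcal{C}^\perp)+2$ (with the convention $d_{\mathrm{rk},0}(\mathcal{C}^\perp)=0$).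
   Context: For $v=(v_1,\dots,v_n)\in\mathbb{F}_{q^m}^n$, the rank weight is $\mathrm{wt}_{\mathrm{rk}}(v)=\dim_{\mathbb{F}_q}\langle v_1,\dots,v_n\rangle_{\mathbb{F}_q}$. An $[n,k]_{q^m/q}$ code is a $k$-dimensional $\mathbb{F}_{q^m}$-subspace $\mathcal{C}\subseteq\mathbb{F}_{q^m}^n$; its minimum rank distance $d_{\mathrm{rk}}(\mathcal{C})$ is the least rank weight of a nonzero codeword. A generator matrix is $G\in\mathbb{F}_{q^m}^{k\times n}$ whose rows span $\mathcal{C}$. The dual code is $\mathcal{C}^\perp=\{v\in\mathbb{F}_{q^m}^n: cv^\top=0\ \forall c\in\mathcal{C}\}$. $\mathcal{C}$ is nondegenerate if the $\mathbb{F}_q$-span of the columns of a generator matrix has $\mathbb{F}_q$-dimension $n$. An $\mathbb{F}_{q^m}$-subspace $\mathcal{A}\subseteq\mathbb{F}_{q^m}^n$ is Galois closed if it is mapped to itself by the coordinatewise $q$-Frobenius map. For $1\le s\le \dim_{\mathbb{F}_{q^m}}\mathcal{C}$, the $s$-th generalized rank weight is $d_{\mathrm{rk},s}(\mathcal{C})=\min\{\dim_{\mathbb{F}_{q^m}}\mathcal{A}: \mathcal{A}\text{ Galois closed}, \dim_{\mathbb{F}_{q^m}}(\mathcal{A}\cap\mathcal{C})\ge s\}$. An $[n,k]_{q^m/q}$ system is an $n$-dimensional $\mathbb{F}_q$-subspace $\mathcal{U}$ of $\mathbb{F}_{q^m}^k$ whose $\mathbb{F}_{q^m}$-span is $\mathbb{F}_{q^m}^k$.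 If $G$ is a generator matrix of a nondegenerate code $\mathcal{C}$ with columns $g_1,\dots,g_n\in\mathbb{F}_{q^m}^k$, the systems associated with $\mathcal{C}$ are the images $\langle g_1,\dots,g_n\rangle_{\mathbb{F}_q}\cdot M$, $M\in\mathrm{GL}(k,q^m)$ (this class does not depend on the choice of $G$). For integers $0\le h<k$ and $r$, a system $\mathcal{U}$ is $(h,r)$-evasive if $\dim_{\mathbb{F}_q}(\mathcal{U}\cap W)\le r$ for every $h$-dimensional $\mathbb{F}_{q^m}$-subspace $W$ of $\mathbb{F}_{q^m}^k$. -}

module Defs where

open import Level using (Level; suc; _⊔_)
open import Data.Nat using (ℕ; zero; _≤_; _<_) renaming (suc to sucℕ; _^_ to _^ℕ_)
open import Data.Nat.Primality using (Prime)
open import Data.Integer using (ℤ; +_) renaming (_≤_ to _≤ℤ_)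
open import Data.Fin using (Fin) renaming (zero to fz; suc to fs)
open import Data.Product using (Σ; ∃; _×_; _,_)
open import Data.Unit.Polymorphic using (⊤)
open import Relation.Binary.PropositionalEquality using (_≡_)
open import Relation.Nullary using (¬_)
open import Function.Bundles using (_↔_)
open import Algebra.Structures using (IsCommutativeRing)

IsPrimePower : ℕ → Set
IsPrimePower q = Σ ℕ λ p → Σ ℕ λ e → Prime p × (1 ≤ e) × (q ≡ p ^ℕ e)

record FiniteField (ℓ : Level) (N : ℕ) : Set (suc ℓ) where
  infixl 6 _+_
  infixl 7 _*_
  field
    Carrier : Set ℓ
    _+_ _*_ : Carrier → Carrier → Carrier
    -_      : Carrier → Carrier
    0# 1#   : Carrier
    isCommutativeRing : IsCommutativeRing _≡_ _+_ _*_ -_ 0# 1#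
    0≢1     : ¬ (0# ≡ 1#)
    inverse : ∀ x → ¬ (x ≡ 0#) → Σ Carrier λ y → x * y ≡ 1#
    enum    : Fin N ↔ Carrier

-- Linear algebra over the field L = F_{q^m}, with scalars ranging over
-- an arbitrary predicate (either all of L, or the subfield F_q).

module LinAlg {ℓ : Level} {N : ℕ} (L : FiniteField ℓ N) where
  open FiniteField L public

  Vec : ℕ → Set ℓ
  Vec n = Fin n → Carrier

  pow : Carrier → ℕ → Carrier
  pow x zero     = 1#
  pow x (sucℕ e) = x * pow x e

  sumFin : (t : ℕ) → (Fin t → Carrier) → Carrier
  sumFin zero     f = 0#
  sumFin (sucℕ t) f = f fz + sumFin t (λ i → f (fs i))

  Scalars : Set (suc ℓ)
  Scalars = Carrier → Set ℓ

  allL : Scalars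
  allL _ = ⊤

  Fq : ℕ → Scalars
  Fq q x = pow x q ≡ x

  zeroVec : ∀ {n} → Vec n
  zeroVec _ = 0#

  _≐_ : ∀ {n} → Vec n → Vec n → Set ℓ
  u ≐ v = ∀ i → u i ≡ v i

  lincomb : ∀ {n t} → (Fin t → Carrier) → (Fin t → Vec n) → Vec n
  lincomb {t = t} c f i = sumFin t (λ j → c j * f j i)

  Span : Scalars → ∀ {n t} → (Fin t → Vec n) → Vec n → Set ℓ
  Span P {t = t} f v = Σ (Fin t → Carrier) λ c → (∀ j → P (c j)) × (v ≐ lincomb c f)

  Independent : Scalars → ∀ {n t} → (Fin t → Vec n) → Set ℓ
  Independent P {t = t} f =
    ∀ (c : Fin t → Carrier) → (∀ j → P (c j)) → lincomb c f ≐ zeroVec → ∀ j → c j ≡ 0#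

  -- dimension (over the scalars P) of a set S of vectors,
  -- as the maximal size of a P-independent family inside S
  DimAtLeast : Scalars → ∀ {n} → (Vec n → Set ℓ) → ℕ → Set ℓ
  DimAtLeast P {n} S d =
    Σ (Fin d → Vec n) λ f → (∀ j → S (f j)) × Independent P f

  DimAtMost : Scalars → ∀ {n} → (Vec n → Set ℓ) → ℤ → Set ℓ
  DimAtMost P {n} S r =
    ∀ (t : ℕ) (f : Fin t → Vec n) → (∀ j → S (f j)) → Independent P f → (+ t) ≤ℤ r

  _∩_ : ∀ {n} → (Vec n → Set ℓ) → (Vec n → Set ℓ) → Vec n → Set ℓ
  (S ∩ T) v = S v × T v

  frob : ℕ → ∀ {n} → Vec n → Vec n
  frob q v i = pow (v i) q

  -- An F_{q^m}-subspace of L^n given by a finite generating family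
  -- (every subspace of L^n is of this form)
  record Subspace (n : ℕ) : Set ℓ where
    constructor subspace
    field
      size : ℕ
      gens : Fin size → Vec n

  mem : ∀ {n} → Subspace n → Vec n → Set ℓ
  mem A = Span allL (Subspace.gens A)

  GaloisClosed : ℕ → ∀ {n} → Subspace n → Set ℓ
  GaloisClosed q A = ∀ v → mem A v → mem A (frob q v)

  Matrix : ℕ → ℕ → Set ℓ
  Matrix k n = Fin k → Fin n → Carrier

  IsGeneratorMatrix : ∀ {k n} → Matrix k n → Set ℓ
  IsGeneratorMatrix G = Independent allL G

  Code : ∀ {k n} → Matrix k n → Vec n → Set ℓ
  Code G = Span allL G

  dot : ∀ {n} → Vec n → Vec n → Carrier
  dot {n} u v = sumFin n (λ i → u i * v i)

  Dual : ∀ {n} → (Vec n → Set ℓ) → Vec n → Set ℓ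
  Dual C v = ∀ c → C c → dot c v ≡ 0#

  columns : ∀ {k n} → Matrix k n → Fin n → Vec k
  columns G j i = G i j

  Nondegenerate : ℕ → ∀ {k n} → Matrix k n → Set ℓ
  Nondegenerate q {k} {n} G =
    DimAtLeast (Fq q) (Span (Fq q) (columns G)) n
    × DimAtMost (Fq q) (Span (Fq q) (columns G)) (+ n)

  _·_ : ∀ {a b c} → Matrix a b → Matrix b c → Matrix a c
  _·_ {b = b} M N i j = sumFin b (λ l → M i l * N l j)

  idMat : ∀ {k} → Matrix k k
  idMat {sucℕ k} fz fz = 1#
  idMat {sucℕ k} fz (fs j) = 0#
  idMat {sucℕ k} (fs i) fz = 0#
  idMat {sucℕ k} (fs i) (fs j) = idMat {k} i j

  IsInvertible : ∀ {k} → Matrix k k → Set ℓ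
  IsInvertible {k} M = Σ (Matrix k k) λ M' → (∀ i j → (M · M') i j ≡ idMat i j)
                                          × (∀ i j → (M' · M) i j ≡ idMat i j)

  _⋆_ : ∀ {k l} → Vec k → Matrix k l → Vec l
  _⋆_ {k} v M j = sumFin k (λ i → v i * M i j)

  System : ℕ → ∀ {k n} → Matrix k n → Matrix k k → Vec k → Set ℓ
  System q G M u = Σ (Vec _) λ v → Span (Fq q) (columns G) v × (u ≐ (v ⋆ M))

  Evasive : ℕ → ∀ {k} → (Vec k → Set ℓ) → ℕ → ℤ → Set ℓ
  Evasive q {k} U h r =
    ∀ (W : Subspace k) → DimAtLeast allL (mem W) h → DimAtMost allL (mem W) (+ h) →
      DimAtMost (Fq q) (U ∩ mem W) r

  -- generalized rank weights of a code C ⊆ L^n: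
  -- d_{rk,s}(C) = min { dim A | A Galois closed, dim (A ∩ C) ≥ s }

  GRWAtLeast : ℕ → ∀ {n} → (Vec n → Set ℓ) → ℕ → ℕ → Set ℓ
  GRWAtLeast q {n} C s t =
    ∀ (A : Subspace n) → GaloisClosed q A → DimAtLeast allL (mem A ∩ C) s →
      DimAtLeast allL (mem A) t

  GRWAtMost : ℕ → ∀ {n} → (Vec n → Set ℓ) → ℕ → ℕ → Set ℓ
  GRWAtMost q {n} C s t =
    Σ (Subspace n) λ A → GaloisClosed q A × DimAtLeast allL (mem A ∩ C) s ×
      DimAtMost allL (mem A) (+ t)

  GRWEq : ℕ → ∀ {n} → (Vec n → Set ℓ) → ℕ → ℕ → Set ℓ
  GRWEq q C s t = GRWAtLeast q C s t × GRWAtMost q C s t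

{-# OPTIONS --safe #-}
-- Every assertion says that a configuration W(b, k − h) exists or does not exist, for b = r or r + 1:
-- b vectors X over F_q, independent over L = F_{q^m}, whose span is orthogonal to a (k − h)-dimensional
-- subcode y G. The orthogonal of ⟨X⟩ is a Galois closed space of dimension n − b meeting C in dimension
-- at least k − h; the span ⟨X⟩ itself meets C^⊥ in dimension at least b − h, by rank–nullity for the
-- b × k matrix X Gᵀ; and, up to M, the columns of G Xᵀ are b F_q-independent vectors of the system in the
-- h-dimensional orthogonal of the y's. The converse passages rest on Galois descent: the reduced echelon
-- basis of a Galois closed space has entries in F_q. Dimensions are compared by counting: an injection
-- L^a → L^b forces a ≤ b. Since L is finite, everything in sight is decidable.
module Submission where

open import Defs
open import Level using (Level)
open import Data.Nat as ℕ using (ℕ; zero; suc; _≤_; _<_; _∸_; _^_; z≤n; s≤s)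
import Data.Nat.Properties as ℕ
open import Data.Nat.Combinatorics using (nCk+nC[k+1]≡[n+1]C[k+1]; nCn≡1) renaming (_C_ to _choose_)
open import Data.Nat.Divisibility using (_∣_; divides; m∣m*n; ∣⇒≤)
open import Data.Nat.Primality using (Prime; euclidsLemma; prime⇒nonZero)
open import Data.Nat.Tactic.RingSolver using (solve-∀)
import Data.Integer as ℤ
import Data.Integer.Properties as ℤ
open import Data.Fin as Fin using (Fin; toℕ; splitAt; inject≤; finToFun; funToFin)
import Data.Fin.Properties as Fin
open import Data.Fin.Permutation using (Permutation; permutation; _⟨$⟩ʳ_)
open import Data.Vec.Functional using (_∷_; _++_)
open import Data.Vec.Functional.Properties using (++-injective)
open import Data.Product using (Σ; ∃; _×_; _,_; proj₁; proj₂)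
open import Data.Sum using (_⊎_; inj₁; inj₂)
open import Data.Empty using (⊥-elim)
open import Data.Unit.Polymorphic using (tt)
open import Function using (_∘_)
open import Function.Bundles using (_⇔_; mk⇔; Inverse; Equivalence)
open import Data.Product.Function.NonDependent.Propositional using (_×-⇔_)
open import Function.Related.TypeIsomorphisms using (¬-cong-⇔)
open import Function.Construct.Composition using (_⇔-∘_)
open import Function.Construct.Symmetry using (⇔-sym)
open import Relation.Nullary using (¬_; Dec; yes; no)
open import Relation.Nullary.Decidable using (map′; _×-dec_; decidable-stable)
open import Relation.Binary.PropositionalEquality
  using (_≡_; refl; sym; trans; cong; cong₂; subst; module ≡-Reasoning)
open import Algebra.Bundles using (CommutativeRing)

-- Binomial coefficients and divisibility by a prime.

-- Induction by Pascal's rule. The multiplied-out form avoids division, so that Euclid's lemma can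
-- be applied to it.
absorption : ∀ n k → suc k ℕ.* (suc n choose suc k) ≡ suc n ℕ.* (n choose k)
absorption zero    zero    = refl
absorption zero    (suc k) = ℕ.*-zeroʳ (suc (suc k))
absorption (suc n) zero    = begin
  1 ℕ.* (suc (suc n) choose 1)                 ≡⟨ cong (1 ℕ.*_) (nCk+nC[k+1]≡[n+1]C[k+1] (suc n) 0) ⟨
  1 ℕ.* (1 ℕ.+ (suc n choose 1))               ≡⟨ step (suc n choose 1) ⟩
  1 ℕ.+ 1 ℕ.* (suc n choose 1)                 ≡⟨ cong (1 ℕ.+_) (absorption n zero) ⟩
  suc (suc n) ℕ.* 1                       ∎
  where
  open ≡-Reasoning
  step : ∀ c → 1 ℕ.* (1 ℕ.+ c) ≡ 1 ℕ.+ 1 ℕ.* c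
  step = solve-∀
absorption (suc n) (suc k) = begin
  suc (suc k) ℕ.* (suc (suc n) choose suc (suc k))
    ≡⟨ cong (suc (suc k) ℕ.*_) (nCk+nC[k+1]≡[n+1]C[k+1] (suc n) (suc k)) ⟨
  suc (suc k) ℕ.* (c ℕ.+ (suc n choose suc (suc k)))
    ≡⟨ step₁ (suc k) c (suc n choose suc (suc k)) ⟩
  c ℕ.+ (suc k ℕ.* c ℕ.+ suc (suc k) ℕ.* (suc n choose suc (suc k)))
    ≡⟨ cong (c ℕ.+_) (cong₂ ℕ._+_ (absorption n k) (absorption n (suc k))) ⟩
  c ℕ.+ (suc n ℕ.* (n choose k) ℕ.+ suc n ℕ.* (n choose suc k))
    ≡⟨ cong (c ℕ.+_) (ℕ.*-distribˡ-+ (suc n) (n choose k) (n choose suc k)) ⟨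
  c ℕ.+ suc n ℕ.* ((n choose k) ℕ.+ (n choose suc k))
    ≡⟨ cong (λ d → c ℕ.+ suc n ℕ.* d) (nCk+nC[k+1]≡[n+1]C[k+1] n k) ⟩
  suc (suc n) ℕ.* c ∎
  where
  open ≡-Reasoning
  c = suc n choose suc k
  step₁ : ∀ k c d → suc k ℕ.* (c ℕ.+ d) ≡ c ℕ.+ (k ℕ.* c ℕ.+ suc k ℕ.* d)
  step₁ = solve-∀

-- By absorption the prime divides `suc k` times the coefficient, and it cannot divide `suc k`,
-- which is positive and smaller.
prime∣binomial : ∀ p k → Prime (suc p) → k < p → suc p ∣ (suc p choose suc k)
prime∣binomial p k isPrime k<p
  with euclidsLemma (suc k) _ isPrime
         (subst (suc p ∣_) (sym (absorption p k)) (m∣m*n (p choose k)))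
... | inj₁ p∣k = ⊥-elim (ℕ.<⇒≱ (s≤s k<p) (∣⇒≤ p∣k))
... | inj₂ p∣C = p∣C

-- Arithmetic of a finite field and additivity of the Frobenius map.

module FieldProperties {ℓ : Level} {N : ℕ} (L : FiniteField ℓ N) where
  open LinAlg L

  ring : CommutativeRing ℓ ℓ
  ring = record { isCommutativeRing = isCommutativeRing }

  open CommutativeRing ring public using
    ( +-assoc; +-comm; +-identityˡ; +-identityʳ; -‿inverseˡ; -‿inverseʳ
    ; *-assoc; *-comm; *-identityˡ; *-identityʳ; distribˡ; distribʳ; zeroˡ; zeroʳ
    ; semiring; commutativeSemiring )
  open import Algebra.Properties.Ring (CommutativeRing.ring ring) public
    using (-‿distribˡ-*; -0#≈0#) renaming (-1*x≈-x to -1*x≡-x)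
  open import Algebra.Properties.Group (CommutativeRing.+-group ring) public
    using () renaming (x∙y⁻¹≈ε⇒x≈y to x-y≡0⇒x≡y; identityʳ-unique to +-identityʳ-unique)
  open import Algebra.Properties.Semiring.Sum semiring public
    using (sum; sum-cong-≗; *-distribˡ-sum; ∑-distrib-+; ∑-comm; sum-permute; sum-replicate)
  open import Algebra.Properties.Semiring.Mult semiring public
    using (×-homo-1; ×1-homo-*; ×-assoc-*) renaming (_×_ to _×ₙ_)
  open import Algebra.Properties.Semiring.Exp semiring using (^-assocʳ) renaming (_^_ to _^ₗ_)
  open import Algebra.Properties.CommutativeSemiring.Exp commutativeSemiring using (^-distrib-*)
  open import Algebra.Properties.CommutativeSemiring.Binomial commutativeSemiring
    using () renaming (theorem to binomial-theorem)
  open Inverse enum using () renaming (to to element; from to index;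
    strictlyInverseˡ to element-index; strictlyInverseʳ to index-element) public

  _≟ₗ_ : (x y : Carrier) → Dec (x ≡ y)
  x ≟ₗ y with index x Fin.≟ index y
  ... | yes eq = yes (trans (sym (element-index x)) (trans (cong element eq) (element-index y)))
  ... | no neq = no (neq ∘ cong index)

  x*y≡0⇒y≡0 : ∀ {x y} → ¬ x ≡ 0# → x * y ≡ 0# → y ≡ 0#
  x*y≡0⇒y≡0 {x} {y} x≢0 xy≡0 with inverse x x≢0
  ... | x⁻¹ , xx⁻¹≡1 = begin
    y              ≡⟨ *-identityˡ y ⟨
    1# * y         ≡⟨ cong (_* y) xx⁻¹≡1 ⟨
    x * x⁻¹ * y    ≡⟨ cong (_* y) (*-comm x x⁻¹) ⟩
    x⁻¹ * x * y    ≡⟨ *-assoc x⁻¹ x y ⟩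
    x⁻¹ * (x * y)  ≡⟨ cong (x⁻¹ *_) xy≡0 ⟩
    x⁻¹ * 0#       ≡⟨ zeroʳ x⁻¹ ⟩
    0#             ∎
    where open ≡-Reasoning

  x^n≡0⇒x≡0 : ∀ n {x} → pow x n ≡ 0# → x ≡ 0#
  x^n≡0⇒x≡0 zero    eq = ⊥-elim (0≢1 (sym eq))
  x^n≡0⇒x≡0 (suc n) {x} eq with x ≟ₗ 0#
  ... | yes x≡0 = x≡0
  ... | no x≢0  = x^n≡0⇒x≡0 n (x*y≡0⇒y≡0 x≢0 eq)

  -- Makes the powers of `N` strictly increasing, so that counting vectors can compare dimensions.
  1<N : 1 < N
  -- `N` is a parameter on which `enum` depends, so the case analysis runs on a copy tied to it by
  -- an equation.
  1<N = go N refl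
    where
    collapse : ∀ {n} → n ≡ 1 → (i j : Fin n) → i ≡ j
    collapse refl Fin.zero Fin.zero = refl
    go : ∀ n → N ≡ n → 1 < n
    go zero          N≡0 = ⊥-elim (Fin.¬Fin0 (subst Fin N≡0 (index 0#)))
    go (suc zero)    N≡1 = ⊥-elim (0≢1 (trans (sym (element-index 0#))
      (trans (cong element (collapse N≡1 (index 0#) (index 1#))) (element-index 1#))))
    go (suc (suc n)) _   = s≤s (s≤s z≤n)

  -- Translation by 1 permutes the field, so the sum of all elements equals itself plus N · 1.
  N×1≡0 : N ×ₙ 1# ≡ 0#
  N×1≡0 = +-identityʳ-unique (sum element) (N ×ₙ 1#) (begin
    sum element + N ×ₙ 1#                ≡⟨ cong (sum element +_) (sum-replicate N) ⟨
    sum element + sum {N} (λ _ → 1#)     ≡⟨ ∑-distrib-+ element (λ _ → 1#) ⟨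
    sum (λ i → element i + 1#)           ≡⟨ sum-cong-≗ (λ i → sym (element-index (element i + 1#))) ⟩
    sum (element ∘ (shift ⟨$⟩ʳ_))        ≡⟨ sum-permute element shift ⟨
    sum element                          ∎)
    where
    open ≡-Reasoning
    cancel : ∀ x y z → y + z ≡ 0# → x + y + z ≡ x
    cancel x y z eq = trans (+-assoc x y z) (trans (cong (x +_) eq) (+-identityʳ x))
    conjugate : ∀ a b → (∀ x → x + a + b ≡ x) →
      ∀ i → index (element (index (element i + a)) + b) ≡ i
    conjugate a b inv i = trans (cong (λ x → index (x + b)) (element-index (element i + a)))
      (trans (cong index (inv (element i))) (index-element i))
    shift : Permutation N N
    shift = permutation (λ i → index (element i + 1#)) (λ i → index (element i + (- 1#)))
      (conjugate (- 1#) 1# (λ x → cancel x _ _ (-‿inverseˡ 1#)))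
      (conjugate 1# (- 1#) (λ x → cancel x _ _ (-‿inverseʳ 1#)))

  pow≡^ : ∀ x n → pow x n ≡ x ^ₗ n
  pow≡^ x zero    = refl
  pow≡^ x (suc n) = cong (x *_) (pow≡^ x n)

  pow-* : ∀ x y n → pow (x * y) n ≡ pow x n * pow y n
  pow-* x y n = trans (pow≡^ _ n) (trans (^-distrib-* x y n) (sym (cong₂ _*_ (pow≡^ x n) (pow≡^ y n))))

  pow-assoc : ∀ x a b → pow (pow x a) b ≡ pow x (a ℕ.* b)
  pow-assoc x a b = begin
    pow (pow x a) b  ≡⟨ pow≡^ _ b ⟩
    pow x a ^ₗ b     ≡⟨ cong (_^ₗ b) (pow≡^ x a) ⟩
    (x ^ₗ a) ^ₗ b    ≡⟨ ^-assocʳ x a b ⟩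
    x ^ₗ (a ℕ.* b)   ≡⟨ pow≡^ x (a ℕ.* b) ⟨
    pow x (a ℕ.* b)  ∎
    where open ≡-Reasoning

  ×1-^ : ∀ p e → (p ^ e) ×ₙ 1# ≡ pow (p ×ₙ 1#) e
  ×1-^ p zero    = ×-homo-1 1#
  ×1-^ p (suc e) = trans (×1-homo-* p (p ^ e)) (cong (p ×ₙ 1# *_) (×1-^ p e))

  -- The e-th power of `p ×ₙ 1#` is `N ×ₙ 1#`, hence zero, and a field has no nilpotents.
  characteristic : ∀ p e → N ≡ p ^ e → p ×ₙ 1# ≡ 0#
  characteristic p e refl = x^n≡0⇒x≡0 e (trans (sym (×1-^ p e)) N×1≡0)

  ∣⇒×≡0 : ∀ {p n} x → p ×ₙ 1# ≡ 0# → p ∣ n → n ×ₙ x ≡ 0#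
  ∣⇒×≡0 {p} x p1≡0 (divides c refl) = begin
    (c ℕ.* p) ×ₙ x               ≡⟨ cong ((c ℕ.* p) ×ₙ_) (*-identityˡ x) ⟨
    (c ℕ.* p) ×ₙ (1# * x)        ≡⟨ ×-assoc-* (c ℕ.* p) 1# x ⟨
    (c ℕ.* p) ×ₙ 1# * x          ≡⟨ cong (_* x) (×1-homo-* c p) ⟩
    c ×ₙ 1# * (p ×ₙ 1#) * x      ≡⟨ cong (λ z → c ×ₙ 1# * z * x) p1≡0 ⟩
    c ×ₙ 1# * 0# * x             ≡⟨ cong (_* x) (zeroʳ _) ⟩
    0# * x                       ≡⟨ zeroˡ x ⟩
    0#                           ∎
    where open ≡-Reasoning

  sum-last : ∀ n (f : Fin (suc n) → Carrier) →
    (∀ i → toℕ i < n → f i ≡ 0#) → sum f ≡ f (Fin.fromℕ n)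
  sum-last zero    f f≡0 = +-identityʳ _
  sum-last (suc n) f f≡0 = trans (cong₂ _+_ (f≡0 Fin.zero (s≤s z≤n))
    (sum-last n (f ∘ Fin.suc) (λ i i<n → f≡0 (Fin.suc i) (s≤s i<n)))) (+-identityˡ _)

  -- Every middle coefficient of the binomial expansion is divisible by `p` and so acts as zero;
  -- only the two end terms remain.
  pow-prime-+ : ∀ p → Prime p → p ×ₙ 1# ≡ 0# → ∀ x y → pow (x + y) p ≡ pow x p + pow y p
  pow-prime-+ zero isPrime _ with () ← prime⇒nonZero isPrime
  pow-prime-+ (suc p) isPrime p1≡0 x y = begin
    pow (x + y) (suc p)                       ≡⟨ pow≡^ _ (suc p) ⟩
    (x + y) ^ₗ suc p                          ≡⟨ binomial-theorem (suc p) x y ⟩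
    term Fin.zero + sum (term ∘ Fin.suc)      ≡⟨ cong₂ _+_ first (sum-last p (term ∘ Fin.suc) middle) ⟩
    y ^ₗ suc p + term (Fin.fromℕ (suc p))     ≡⟨ cong (y ^ₗ suc p +_) last ⟩
    y ^ₗ suc p + x ^ₗ suc p                   ≡⟨ +-comm _ _ ⟩
    x ^ₗ suc p + y ^ₗ suc p                   ≡⟨ cong₂ _+_ (pow≡^ x (suc p)) (pow≡^ y (suc p)) ⟨
    pow x (suc p) + pow y (suc p)             ∎
    where
    open ≡-Reasoning
    term : Fin (suc (suc p)) → Carrier
    term i = (suc p choose toℕ i) ×ₙ (x ^ₗ toℕ i * y ^ₗ (suc p ∸ toℕ i))
    first : term Fin.zero ≡ y ^ₗ suc p
    first = trans (×-homo-1 _) (*-identityˡ _)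
    middle : ∀ i → toℕ i < p → term (Fin.suc i) ≡ 0#
    middle i i<p = ∣⇒×≡0 _ p1≡0 (prime∣binomial p (toℕ i) isPrime i<p)
    last : term (Fin.fromℕ (suc p)) ≡ x ^ₗ suc p
    last rewrite Fin.toℕ-fromℕ p | nCn≡1 (suc p) | ℕ.n∸n≡0 p = trans (×-homo-1 _) (*-identityʳ _)

  pow-prime-power-+ : ∀ p e → Prime p → p ×ₙ 1# ≡ 0# →
    ∀ x y → pow (x + y) (p ^ e) ≡ pow x (p ^ e) + pow y (p ^ e)
  pow-prime-power-+ p zero    isPrime p1≡0 x y = trans (*-identityʳ _)
    (sym (cong₂ _+_ (*-identityʳ x) (*-identityʳ y)))
  pow-prime-power-+ p (suc e) isPrime p1≡0 x y = begin
    pow (x + y) (p ℕ.* p ^ e)                          ≡⟨ pow-assoc (x + y) p (p ^ e) ⟨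
    pow (pow (x + y) p) (p ^ e)
      ≡⟨ cong (λ z → pow z (p ^ e)) (pow-prime-+ p isPrime p1≡0 x y) ⟩
    pow (pow x p + pow y p) (p ^ e)                    ≡⟨ pow-prime-power-+ p e isPrime p1≡0 _ _ ⟩
    pow (pow x p) (p ^ e) + pow (pow y p) (p ^ e)      ≡⟨ cong₂ _+_ (pow-assoc x p (p ^ e)) (pow-assoc y p (p ^ e)) ⟩
    pow x (p ℕ.* p ^ e) + pow y (p ℕ.* p ^ e)          ∎
    where open ≡-Reasoning

  -- With q = p^e the field has p^(em) elements, so `p` vanishes in it and the q-th power is an
  -- iterated p-th power.
  frobenius-+ : ∀ q m → IsPrimePower q → N ≡ q ^ m → ∀ x y → pow (x + y) q ≡ pow x q + pow y q
  frobenius-+ q m (p , e , isPrime , _ , refl) N≡q^m =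
    pow-prime-power-+ p e isPrime (characteristic p (e ℕ.* m) (trans N≡q^m (ℕ.^-*-assoc p e m)))

-- Finite sums, dot products and linear combinations.

module LinearAlgebra {ℓ : Level} {N : ℕ} (L : FiniteField ℓ N) where
  open LinAlg L public
  open FieldProperties L

  -- The bridge along which library facts about `sum` reach the sums of the definitions.
  sumFin≡sum : ∀ t (f : Fin t → Carrier) → sumFin t f ≡ sum f
  sumFin≡sum zero    f = refl
  sumFin≡sum (suc t) f = cong (_ +_) (sumFin≡sum t (f ∘ Fin.suc))

  sumFin-cong : ∀ t {f g : Fin t → Carrier} → (∀ i → f i ≡ g i) → sumFin t f ≡ sumFin t g
  sumFin-cong zero    f≗g = refl
  sumFin-cong (suc t) f≗g = cong₂ _+_ (f≗g Fin.zero) (sumFin-cong t (f≗g ∘ Fin.suc))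

  sumFin-zero : ∀ t {f : Fin t → Carrier} → (∀ i → f i ≡ 0#) → sumFin t f ≡ 0#
  sumFin-zero zero    f≗0 = refl
  sumFin-zero (suc t) f≗0 = trans (cong₂ _+_ (f≗0 Fin.zero) (sumFin-zero t (f≗0 ∘ Fin.suc))) (+-identityˡ 0#)

  sumFin-+ : ∀ t (f g : Fin t → Carrier) → sumFin t (λ i → f i + g i) ≡ sumFin t f + sumFin t g
  sumFin-+ t f g = trans (sumFin≡sum t _) (trans (∑-distrib-+ f g)
    (sym (cong₂ _+_ (sumFin≡sum t f) (sumFin≡sum t g))))

  sumFin-* : ∀ t a (f : Fin t → Carrier) → sumFin t (λ i → a * f i) ≡ a * sumFin t f
  sumFin-* t a f = trans (sumFin≡sum t _) (trans (sym (*-distribˡ-sum a f))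
    (cong (a *_) (sym (sumFin≡sum t f))))

  sumFin-swap : ∀ s t (f : Fin s → Fin t → Carrier) →
    sumFin s (λ i → sumFin t (f i)) ≡ sumFin t (λ j → sumFin s (λ i → f i j))
  sumFin-swap s t f = begin
    sumFin s (λ i → sumFin t (f i))          ≡⟨ sumFin-cong s (λ i → sumFin≡sum t (f i)) ⟩
    sumFin s (λ i → sum (f i))               ≡⟨ sumFin≡sum s _ ⟩
    sum (λ i → sum (f i))                    ≡⟨ ∑-comm f ⟩
    sum (λ j → sum (λ i → f i j))            ≡⟨ sumFin≡sum t _ ⟨
    sumFin t (λ j → sum (λ i → f i j))       ≡⟨ sumFin-cong t (λ j → sumFin≡sum s (λ i → f i j)) ⟨
    sumFin t (λ j → sumFin s (λ i → f i j))  ∎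
    where open ≡-Reasoning

  sumFin-single : ∀ t (p : Fin t) (f : Fin t → Carrier) →
    (∀ i → ¬ i ≡ p → f i ≡ 0#) → sumFin t f ≡ f p
  sumFin-single (suc t) Fin.zero    f f≡0 =
    trans (cong (f Fin.zero +_) (sumFin-zero t (λ i → f≡0 (Fin.suc i) λ ()))) (+-identityʳ _)
  sumFin-single (suc t) (Fin.suc p) f f≡0 = trans (cong₂ _+_ (f≡0 Fin.zero λ ())
    (sumFin-single t p (f ∘ Fin.suc) (λ i i≢p → f≡0 (Fin.suc i) (i≢p ∘ Fin.suc-injective)))) (+-identityˡ _)

  infixl 6 _⊖_
  _⊖_ : ∀ {n} → Vec n → Vec n → Vec n
  (u ⊖ v) i = u i + - v i

  sumFin-⊖ : ∀ t (f g : Fin t → Carrier) → sumFin t (λ i → f i + - g i) ≡ sumFin t f + - sumFin t g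
  sumFin-⊖ t f g = trans (sumFin-+ t f (λ i → - g i)) (cong (sumFin t f +_)
    (trans (sumFin-cong t (λ i → sym (-1*x≡-x (g i)))) (trans (sumFin-* t (- 1#) g) (-1*x≡-x _))))

  dot-cong : ∀ {n} {u u′ v v′ : Vec n} → u ≐ u′ → v ≐ v′ → dot u v ≡ dot u′ v′
  dot-cong u≐u′ v≐v′ = sumFin-cong _ (λ i → cong₂ _*_ (u≐u′ i) (v≐v′ i))

  dot-comm : ∀ {n} (u v : Vec n) → dot u v ≡ dot v u
  dot-comm u v = sumFin-cong _ (λ i → *-comm (u i) (v i))

  dot-zeroʳ : ∀ {n} (u : Vec n) {v : Vec n} → v ≐ zeroVec → dot u v ≡ 0#
  dot-zeroʳ u v≐0 = sumFin-zero _ (λ i → trans (cong (u i *_) (v≐0 i)) (zeroʳ (u i)))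

  dot-zeroˡ : ∀ {n} {u : Vec n} (v : Vec n) → u ≐ zeroVec → dot u v ≡ 0#
  dot-zeroˡ v u≐0 = trans (dot-comm _ v) (dot-zeroʳ v u≐0)

  dot-+ : ∀ {n} (a u v : Vec n) → dot a (λ i → u i + v i) ≡ dot a u + dot a v
  dot-+ {n} a u v = trans (sumFin-cong n (λ i → distribˡ (a i) (u i) (v i))) (sumFin-+ n _ _)

  dot-* : ∀ {n} (a : Vec n) x (u : Vec n) → dot a (λ i → x * u i) ≡ x * dot a u
  dot-* {n} a x u = trans (sumFin-cong n λ i →
    trans (sym (*-assoc (a i) x (u i))) (trans (cong (_* u i) (*-comm (a i) x)) (*-assoc x (a i) (u i))))
    (sumFin-* n x _)

  dot-⊖ : ∀ {n} (u v a : Vec n) → dot (u ⊖ v) a ≡ dot u a + - dot v a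
  dot-⊖ {n} u v a = trans (sumFin-cong n λ i →
    trans (distribʳ (a i) (u i) (- v i)) (cong (u i * a i +_) (sym (-‿distribˡ-* (v i) (a i)))))
    (sumFin-⊖ n _ _)

  dot-lincomb : ∀ {n t} (c : Fin t → Carrier) (f : Fin t → Vec n) (v : Vec n) →
    dot (lincomb c f) v ≡ dot c (λ j → dot (f j) v)
  dot-lincomb {n} {t} c f v = begin
    sumFin n (λ i → sumFin t (λ j → c j * f j i) * v i)
      ≡⟨ sumFin-cong n (λ i → trans (*-comm _ (v i)) (sym (sumFin-* t (v i) _))) ⟩
    sumFin n (λ i → sumFin t (λ j → v i * (c j * f j i)))
      ≡⟨ sumFin-swap n t _ ⟩
    sumFin t (λ j → sumFin n (λ i → v i * (c j * f j i)))
      ≡⟨ sumFin-cong t (λ j → trans (sumFin-cong n (λ i → trans (*-comm (v i) _) (*-assoc (c j) (f j i) (v i))))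
           (sumFin-* n (c j) _)) ⟩
    sumFin t (λ j → c j * sumFin n (λ i → f j i * v i)) ∎
    where open ≡-Reasoning

  lincomb-assoc : ∀ {n s t} (x : Fin s → Carrier) (C : Fin s → Vec t) (g : Fin t → Vec n) →
    lincomb (lincomb x C) g ≐ lincomb x (λ j → lincomb (C j) g)
  lincomb-assoc x C g i = dot-lincomb x C (columns g i)

  lincomb-cong : ∀ {n t} {c d : Fin t → Carrier} {f g : Fin t → Vec n} →
    c ≐ d → (∀ j → f j ≐ g j) → lincomb c f ≐ lincomb d g
  lincomb-cong c≐d f≐g i = dot-cong c≐d (λ j → f≐g j i)

  lincomb-⊖ : ∀ {n t} (x y : Vec t) (f : Fin t → Vec n) → lincomb (x ⊖ y) f ≐ (lincomb x f ⊖ lincomb y f)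
  lincomb-⊖ x y f i = dot-⊖ x y (columns f i)

  -- Adjointness of `G` and its transpose: it trades orthogonality of a system vector to `y` for
  -- orthogonality of the codeword y G to `x`.
  dot-columns : ∀ {k n} (G : Matrix k n) (x : Vec n) (y : Vec k) →
    dot (lincomb x (columns G)) y ≡ dot (lincomb y G) x
  dot-columns G x y = begin
    dot (lincomb x (columns G)) y           ≡⟨ dot-lincomb x (columns G) y ⟩
    dot x (λ j → dot (columns G j) y)       ≡⟨ dot-cong (λ _ → refl) (λ j → dot-comm (columns G j) y) ⟩
    dot x (lincomb y G)                     ≡⟨ dot-comm x _ ⟩
    dot (lincomb y G) x                     ∎
    where open ≡-Reasoning

  lincomb-idMat : ∀ {k} (v : Vec k) → lincomb v idMat ≐ v
  lincomb-idMat {suc k} v Fin.zero    = trans (cong₂ _+_ (*-identityʳ _)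
    (sumFin-zero k (λ i → zeroʳ _))) (+-identityʳ _)
  lincomb-idMat {suc k} v (Fin.suc i) = trans (cong₂ _+_ (zeroʳ _) (lincomb-idMat (v ∘ Fin.suc) i)) (+-identityˡ _)

  -- `lincomb v M` unfolds to the same sum as `v ⋆ M`, so this undoes the action of `M` on a system.
  lincomb-inverse : ∀ {k} (M M′ : Matrix k k) → (∀ i j → (M · M′) i j ≡ idMat i j) →
    ∀ v → lincomb (lincomb v M) M′ ≐ v
  lincomb-inverse M M′ MM′≡1 v i = trans (lincomb-assoc v M M′ i)
    (trans (lincomb-cong {c = v} (λ _ → refl) MM′≡1 i) (lincomb-idMat v i))

  -- Subspaces, kernels and spans.

  -- Vectors are functions compared pointwise, so invariance under `≐` is part of the notion.
  record IsSubspace {n} (S : Vec n → Set ℓ) : Set ℓ where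
    field
      resp  : ∀ {u v} → u ≐ v → S u → S v
      zero∈ : S zeroVec
      +∈    : ∀ {u v} → S u → S v → S (λ i → u i + v i)
      *∈    : ∀ a {u} → S u → S (λ i → a * u i)

    ⊖∈ : ∀ {u v} → S u → S v → S (u ⊖ v)
    ⊖∈ {u} {v} Su Sv = resp (λ i → cong (u i +_) (-1*x≡-x (v i))) (+∈ Su (*∈ (- 1#) Sv))

    lincomb∈ : ∀ {t} (c : Fin t → Carrier) {f : Fin t → Vec n} → (∀ j → S (f j)) → S (lincomb c f)
    lincomb∈ {zero}  c Sf = zero∈
    lincomb∈ {suc t} c Sf = +∈ (*∈ (c Fin.zero) (Sf Fin.zero)) (lincomb∈ (c ∘ Fin.suc) (Sf ∘ Fin.suc))

  DecidableSet : ∀ {n} → (Vec n → Set ℓ) → Set ℓ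
  DecidableSet S = ∀ v → Dec (S v)

  -- Serves both as a null space and as the orthogonal of the family of rows; `Ker (columns M)` is
  -- the space of relations among the rows of `M`.
  Ker : ∀ {t n} → Matrix t n → Vec n → Set ℓ
  Ker M v = ∀ i → dot (M i) v ≡ 0#

  Ker-subspace : ∀ {t n} (M : Matrix t n) → IsSubspace (Ker M)
  Ker-subspace M = record
    { resp  = λ u≐v Mu i → trans (dot-cong (λ _ → refl) (λ j → sym (u≐v j))) (Mu i)
    ; zero∈ = λ i → dot-zeroʳ (M i) (λ _ → refl)
    ; +∈    = λ {u} {v} Mu Mv i → trans (dot-+ (M i) u v) (trans (cong₂ _+_ (Mu i) (Mv i)) (+-identityˡ 0#))
    ; *∈    = λ a {u} Mu i → trans (dot-* (M i) a u) (trans (cong (a *_) (Mu i)) (zeroʳ a))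
    }

  Ker? : ∀ {t n} (M : Matrix t n) → DecidableSet (Ker M)
  Ker? M v = Fin.all? (λ i → dot (M i) v ≟ₗ 0#)

  Span-subspace : ∀ {t n} (f : Fin t → Vec n) → IsSubspace (Span allL f)
  Span-subspace {t} f = record
    { resp  = λ u≐v (c , _ , u≐) → c , _ , λ i → trans (sym (u≐v i)) (u≐ i)
    ; zero∈ = zeroVec , _ , λ i → sym (dot-zeroˡ (columns f i) (λ _ → refl))
    ; +∈    = λ (c , _ , u≐) (d , _ , v≐) → (λ j → c j + d j) , _ , λ i →
        trans (cong₂ _+_ (u≐ i) (v≐ i)) (sym (trans (dot-comm _ (columns f i))
          (trans (dot-+ (columns f i) c d) (cong₂ _+_ (dot-comm _ c) (dot-comm _ d)))))
    ; *∈    = λ a (c , _ , u≐) → (λ j → a * c j) , _ , λ i →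
        trans (cong (a *_) (u≐ i)) (sym (trans (dot-comm _ (columns f i))
          (trans (dot-* (columns f i) a c) (cong (a *_) (dot-comm _ c)))))
    }

  gen∈Span : ∀ {t n} (f : Fin t → Vec n) j → Span allL f (f j)
  gen∈Span {t} f j = idMat j , _ , λ i → sym (begin
    sumFin t (λ l → idMat j l * f l i)
      ≡⟨ sumFin-single t j _ (λ l l≢j → trans (cong (_* f l i) (off j l (l≢j ∘ sym))) (zeroˡ _)) ⟩
    idMat j j * f j i                  ≡⟨ cong (_* f j i) (diag j) ⟩
    1# * f j i                         ≡⟨ *-identityˡ _ ⟩
    f j i                              ∎)
    where
    open ≡-Reasoning
    diag : ∀ {k} (i : Fin k) → idMat i i ≡ 1#
    diag Fin.zero    = refl
    diag (Fin.suc i) = diag i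
    off : ∀ {k} (i l : Fin k) → ¬ i ≡ l → idMat i l ≡ 0#
    off Fin.zero    Fin.zero    i≢l = ⊥-elim (i≢l refl)
    off Fin.zero    (Fin.suc l) _   = refl
    off (Fin.suc i) Fin.zero    _   = refl
    off (Fin.suc i) (Fin.suc l) i≢l = off i l (i≢l ∘ cong Fin.suc)

  -- Exhaustive search and reduced echelon bases.

  -- Enumeration reaches a function only up to pointwise equality, hence the demand that `P` respect
  -- the relation.
  Searchable : (A : Set ℓ) → (A → A → Set ℓ) → Set _
  Searchable A _≈_ = ∀ (P : A → Set ℓ) → (∀ {x y} → x ≈ y → P x → P y) → (∀ x → Dec (P x)) → Dec (∃ P)

  searchCarrier : Searchable Carrier _≡_
  searchCarrier P _ P? = map′ (λ (i , Pi) → element i , Pi)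
    (λ (x , Px) → index x , subst P (sym (element-index x)) Px) (Fin.any? (P? ∘ element))

  searchFun : ∀ {A : Set ℓ} {_≈_ : A → A → Set ℓ} → (∀ {x} → x ≈ x) → Searchable A _≈_ →
    ∀ n → Searchable (Fin n → A) (λ f g → ∀ i → f i ≈ g i)
  searchFun refl≈ search zero P resp P? =
    map′ (λ P[] → _ , P[]) (λ (f , Pf) → resp (λ ()) Pf) (P? (λ ()))
  searchFun {A} {_≈_} refl≈ search (suc n) P resp P? = map′
    (λ (x , f , P∷) → x ∷ f , P∷)
    (λ (f , Pf) → f Fin.zero , f ∘ Fin.suc , resp (λ { Fin.zero → refl≈ ; (Fin.suc i) → refl≈ }) Pf)
    (search _ (λ x≈y (f , Pf) → f , resp (λ { Fin.zero → x≈y ; (Fin.suc i) → refl≈ }) Pf)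
      (λ x → searchFun {_≈_ = _≈_} refl≈ search n _
        (λ f≈g → resp (λ { Fin.zero → refl≈ ; (Fin.suc i) → f≈g i }))
        (λ f → P? (x ∷ f))))

  searchVec : ∀ n → Searchable (Vec n) _≐_
  searchVec = searchFun refl searchCarrier

  Span? : ∀ {t n} (f : Fin t → Vec n) → DecidableSet (Span allL f)
  Span? {t} f v = map′ (λ (c , v≐) → c , _ , v≐) (λ (c , _ , v≐) → c , v≐)
    (searchVec t (λ c → v ≐ lincomb c f)
      (λ c≐d v≐ i → trans (v≐ i) (lincomb-cong {f = f} c≐d (λ _ _ → refl) i))
      (λ c → Fin.all? (λ i → v i ≟ₗ lincomb c f i)))

  -- A reduced echelon basis of S; the `free` coordinates are those that are not pivots.
  record Echelon {n} (S : Vec n → Set ℓ) : Set ℓ where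
    field
      rank corank : ℕ
      rank+corank : rank ℕ.+ corank ≡ n
      basis       : Fin rank → Vec n
      pivot       : Fin rank → Fin n
      free        : Fin corank → Fin n
      cover       : ∀ i → (∃ λ j → pivot j ≡ i) ⊎ (∃ λ c → free c ≡ i)
      basis∈      : ∀ j → S (basis j)
      unit        : ∀ j → basis j (pivot j) ≡ 1#
      off         : ∀ j l → ¬ l ≡ j → basis j (pivot l) ≡ 0#
      determined  : ∀ v → S v → (∀ j → v (pivot j) ≡ 0#) → v ≐ zeroVec

    lincomb-pivot : ∀ c l → lincomb c basis (pivot l) ≡ c l
    lincomb-pivot c l = begin
      lincomb c basis (pivot l)
        ≡⟨ sumFin-single rank l _ (λ j j≢l → trans (cong (c j *_) (off j l (j≢l ∘ sym))) (zeroʳ _)) ⟩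
      c l * basis l (pivot l)       ≡⟨ cong (c l *_) (unit l) ⟩
      c l * 1#                      ≡⟨ *-identityʳ _ ⟩
      c l                           ∎
      where open ≡-Reasoning

    basis-independent : Independent allL basis
    basis-independent c _ c·basis≐0 l = trans (sym (lincomb-pivot c l)) (c·basis≐0 (pivot l))

    module _ (S-sub : IsSubspace S) where
      open IsSubspace S-sub

      -- The difference lies in `S` and vanishes at all pivots, so `determined` applies. Through
      -- `expand` this yields that the basis spans.
      agree : ∀ {u v} → S u → S v → (∀ j → u (pivot j) ≡ v (pivot j)) → u ≐ v
      agree {u} {v} Su Sv u≡v i = x-y≡0⇒x≡y (u i) (v i) (determined (u ⊖ v) (⊖∈ Su Sv)
        (λ j → trans (cong (_+ - v (pivot j)) (u≡v j)) (-‿inverseʳ _)) i)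

      expand : ∀ {v} → S v → v ≐ lincomb (v ∘ pivot) basis
      expand Sv = agree Sv (lincomb∈ _ basis∈) (λ j → sym (lincomb-pivot _ j))

      ∈Span-basis : ∀ {v} → S v → Span allL basis v
      ∈Span-basis {v} Sv = v ∘ pivot , _ , expand Sv

  tail-subspace : ∀ {n} {S : Vec (suc n) → Set ℓ} → IsSubspace S → IsSubspace (λ v → S (0# ∷ v))
  tail-subspace S-sub = record
    { resp  = λ u≐v → resp (λ { Fin.zero → refl ; (Fin.suc i) → u≐v i })
    ; zero∈ = resp (λ { Fin.zero → refl ; (Fin.suc i) → refl }) zero∈
    ; +∈    = λ Su Sv → resp (λ { Fin.zero → +-identityˡ 0# ; (Fin.suc i) → refl }) (+∈ Su Sv)
    ; *∈    = λ a Su → resp (λ { Fin.zero → zeroʳ a ; (Fin.suc i) → refl }) (*∈ a Su)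
    }
    where open IsSubspace S-sub

  -- Gaussian elimination without generators: the first coordinate is a pivot exactly when a search
  -- finds a vector of `S` with leading entry 1. In both cases the recursion treats the vectors with
  -- leading entry 0.
  echelon : ∀ {n} {S : Vec n → Set ℓ} → IsSubspace S → DecidableSet S → Echelon S
  echelon {zero} S-sub S? = record
    { rank = 0 ; corank = 0 ; rank+corank = refl
    ; basis = λ () ; pivot = λ () ; free = λ () ; cover = λ () ; basis∈ = λ ()
    ; unit = λ () ; off = λ () ; determined = λ _ _ _ ()
    }
  echelon {suc n} {S} S-sub S? with
    searchVec n (λ v → S (1# ∷ v))
      (λ u≐v → IsSubspace.resp S-sub (λ { Fin.zero → refl ; (Fin.suc i) → u≐v i })) (λ v → S? (1# ∷ v))
  ... | no ∄v = record
    { rank = T.rank ; corank = suc T.corank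
    ; rank+corank = trans (ℕ.+-suc T.rank T.corank) (cong suc T.rank+corank)
    ; basis = λ j → 0# ∷ T.basis j ; pivot = Fin.suc ∘ T.pivot ; free = Fin.zero ∷ (Fin.suc ∘ T.free)
    ; cover = λ { Fin.zero → inj₂ (Fin.zero , refl) ; (Fin.suc i) → cover′ i }
    ; basis∈ = T.basis∈ ; unit = T.unit ; off = T.off
    ; determined = λ v Sv v≡0 → λ
        { Fin.zero → head≡0 v Sv
        ; (Fin.suc i) → T.determined (v ∘ Fin.suc)
            (resp (λ { Fin.zero → head≡0 v Sv ; (Fin.suc _) → refl }) Sv) v≡0 i }
    }
    where
    open IsSubspace S-sub
    module T = Echelon (echelon (tail-subspace S-sub) (λ v → S? (0# ∷ v)))
    cover′ : ∀ i → _
    cover′ i with T.cover i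
    ... | inj₁ (j , refl) = inj₁ (j , refl)
    ... | inj₂ (c , refl) = inj₂ (Fin.suc c , refl)
    head≡0 : ∀ v → S v → v Fin.zero ≡ 0#
    head≡0 v Sv with v Fin.zero ≟ₗ 0#
    ... | yes v₀≡0 = v₀≡0
    ... | no v₀≢0 with inverse _ v₀≢0
    ...   | a , v₀a≡1 = ⊥-elim (∄v ((λ i → a * v (Fin.suc i)) ,
            resp (λ { Fin.zero → trans (*-comm a _) v₀a≡1 ; (Fin.suc i) → refl }) (*∈ a Sv)))
  ... | yes (u , Su) = record
    { rank = suc T.rank ; corank = T.corank ; rank+corank = cong suc T.rank+corank
    ; basis = (1# ∷ u′) ∷ (λ j → 0# ∷ T.basis j) ; pivot = Fin.zero ∷ (Fin.suc ∘ T.pivot)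
    ; free = Fin.suc ∘ T.free
    ; cover = λ { Fin.zero → inj₁ (Fin.zero , refl) ; (Fin.suc i) → cover′ i }
    ; basis∈ = λ { Fin.zero → Su′ ; (Fin.suc j) → T.basis∈ j }
    ; unit = λ { Fin.zero → refl ; (Fin.suc j) → T.unit j }
    ; off = λ
        { Fin.zero    Fin.zero    0≢0 → ⊥-elim (0≢0 refl)
        ; Fin.zero    (Fin.suc l) _   → trans (cong (λ x → u (T.pivot l) + - x) (T.lincomb-pivot _ l)) (-‿inverseʳ _)
        ; (Fin.suc j) Fin.zero    _   → refl
        ; (Fin.suc j) (Fin.suc l) l≢j → T.off j l (l≢j ∘ cong Fin.suc) }
    ; determined = λ v Sv v≡0 → λ
        { Fin.zero → v≡0 Fin.zero
        ; (Fin.suc i) → T.determined (v ∘ Fin.suc)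
            (resp (λ { Fin.zero → v≡0 Fin.zero ; (Fin.suc _) → refl }) Sv) (v≡0 ∘ Fin.suc) i }
    }
    where
    open IsSubspace S-sub
    module T = Echelon (echelon (tail-subspace S-sub) (λ v → S? (0# ∷ v)))
    cover′ : ∀ i → _
    cover′ i with T.cover i
    ... | inj₁ (j , refl) = inj₁ (Fin.suc j , refl)
    ... | inj₂ (c , refl) = inj₂ (c , refl)
    -- Clearing the entries of `u` at the later pivots keeps the basis reduced.
    u′ : Vec n
    u′ = u ⊖ lincomb (u ∘ T.pivot) T.basis
    Su′ : S (1# ∷ u′)
    Su′ = resp (λ { Fin.zero → trans (cong (1# +_) -0#≈0#) (+-identityʳ 1#) ; (Fin.suc i) → refl })
      (⊖∈ Su (IsSubspace.lincomb∈ (tail-subspace S-sub) (u ∘ T.pivot) T.basis∈))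

  -- Comparison of dimensions by counting.

  -- Pigeonhole: for b < a, the `N ^ a` codes of vectors would embed into the strictly smaller set
  -- of `N ^ b` codes.
  injection⇒≤ : ∀ {a b} (F : Vec a → Vec b) → (∀ x y → F x ≐ F y → x ≐ y) → a ≤ b
  injection⇒≤ {a} {b} F F-inj = ℕ.≮⇒≥ λ b<a →
    ℕ.<⇒≱ (ℕ.^-monoʳ-< N 1<N b<a) (Fin.injective⇒≤ {f = encode} encode-inj)
    where
    decode : Fin (N ^ a) → Vec a
    decode x = element ∘ finToFun x
    encode : Fin (N ^ a) → Fin (N ^ b)
    encode x = funToFin (index ∘ F (decode x))
    encode-inj : ∀ {x y} → encode x ≡ encode y → x ≡ y
    encode-inj {x} {y} eq = begin
      x                      ≡⟨ Fin.funToFin-finToFin {a} {N} x ⟨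
      funToFin (finToFun {N} {a} x)  ≡⟨ funToFin-cong x≗y ⟩
      funToFin (finToFun {N} {a} y)  ≡⟨ Fin.funToFin-finToFin {a} {N} y ⟩
      y                      ∎
      where
      open ≡-Reasoning
      funToFin-cong : ∀ {m n} {f g : Fin m → Fin n} → (∀ i → f i ≡ g i) → funToFin f ≡ funToFin g
      funToFin-cong {zero}  f≗g = refl
      funToFin-cong {suc m} f≗g = cong₂ Fin.combine (f≗g Fin.zero) (funToFin-cong (f≗g ∘ Fin.suc))
      Fx≐Fy : F (decode x) ≐ F (decode y)
      Fx≐Fy i = trans (sym (element-index _)) (trans (cong element
        (trans (sym (Fin.finToFun-funToFin (index ∘ F (decode x)) i))
          (trans (cong (λ z → finToFun z i) eq) (Fin.finToFun-funToFin (index ∘ F (decode y)) i))))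
        (element-index _))
      x≗y : ∀ i → finToFun {N} {a} x i ≡ finToFun y i
      x≗y i = trans (sym (index-element _)) (trans (cong index (F-inj _ _ Fx≐Fy i)) (index-element _))

  linear-injection⇒≤ : ∀ {a b} (F : Vec a → Vec b) → (∀ x y → F (x ⊖ y) ≐ (F x ⊖ F y)) →
    (∀ x → F x ≐ zeroVec → x ≐ zeroVec) → a ≤ b
  linear-injection⇒≤ F F-⊖ F-ker = injection⇒≤ F λ x y Fx≐Fy i → x-y≡0⇒x≡y (x i) (y i)
    (F-ker (x ⊖ y) (λ j → trans (F-⊖ x y j) (trans (cong (_+ - F y j) (Fx≐Fy j)) (-‿inverseʳ _))) i)

  -- Steinitz bound: the coefficient matrix `C` acts on row vectors without kernel, since x C = 0
  -- makes the combination `x` of `f` vanish.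
  independent-in-Span⇒≤ : ∀ {n s t} {f : Fin s → Vec n} {g : Fin t → Vec n} →
    (∀ j → Span allL g (f j)) → Independent allL f → s ≤ t
  independent-in-Span⇒≤ {f = f} {g} f∈ f-ind = linear-injection⇒≤ (λ x → lincomb x C)
    (λ x y → lincomb-⊖ x y C)
    (λ x xC≐0 → f-ind x _ λ i → begin
      lincomb x f i                            ≡⟨ lincomb-cong {c = x} (λ _ → refl) (λ j → proj₂ (proj₂ (f∈ j))) i ⟩
      lincomb x (λ j → lincomb (C j) g) i      ≡⟨ lincomb-assoc x C g i ⟨
      lincomb (lincomb x C) g i                ≡⟨ dot-zeroˡ (columns g i) xC≐0 ⟩
      0#                                       ∎)
    where
    open ≡-Reasoning
    C = λ j → proj₁ (f∈ j)

  Span-atMost : ∀ {n t} (g : Fin t → Vec n) → DimAtMost allL (Span allL g) (ℤ.+ t)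
  Span-atMost g s f f∈ f-ind = ℤ.+≤+ (independent-in-Span⇒≤ f∈ f-ind)

  -- A relation among the first `s` vectors is padded with zeros to a relation among all, hence the
  -- condition `P 0#`.
  inject≤-independent : ∀ P {n s t} {f : Fin t → Vec n} (s≤t : s ≤ t) → P 0# →
    Independent P f → Independent P (λ j → f (inject≤ j s≤t))
  inject≤-independent P {n} {f = f} s≤t P0 f-ind c Pc cf≐0 j =
    trans (sym (extend-inject s≤t c j)) (f-ind (extend s≤t c) (extend-P s≤t c Pc)
      (λ i → trans (extend-sum s≤t c (λ l → f l i)) (cf≐0 i)) (inject≤ j s≤t))
    where
    extend : ∀ {s t} → s ≤ t → Vec s → Vec t
    extend z≤n       c _           = 0#
    extend (s≤s s≤t) c Fin.zero    = c Fin.zero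
    extend (s≤s s≤t) c (Fin.suc i) = extend s≤t (c ∘ Fin.suc) i
    extend-P : ∀ {s t} (s≤t : s ≤ t) c → (∀ j → P (c j)) → ∀ i → P (extend s≤t c i)
    extend-P z≤n       c Pc i           = P0
    extend-P (s≤s s≤t) c Pc Fin.zero    = Pc Fin.zero
    extend-P (s≤s s≤t) c Pc (Fin.suc i) = extend-P s≤t (c ∘ Fin.suc) (Pc ∘ Fin.suc) i
    extend-inject : ∀ {s t} (s≤t : s ≤ t) c j → extend s≤t c (inject≤ j s≤t) ≡ c j
    extend-inject (s≤s s≤t) c Fin.zero    = refl
    extend-inject (s≤s s≤t) c (Fin.suc j) = extend-inject s≤t (c ∘ Fin.suc) j
    extend-sum : ∀ {s t} (s≤t : s ≤ t) c (g : Vec t) → dot (extend s≤t c) g ≡ dot c (λ j → g (inject≤ j s≤t))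
    extend-sum z≤n       c g = dot-zeroˡ g (λ _ → refl)
    extend-sum (s≤s s≤t) c g = cong (c Fin.zero * g Fin.zero +_) (extend-sum s≤t (c ∘ Fin.suc) (g ∘ Fin.suc))

  shrink : ∀ {n s t} {S : Vec n → Set ℓ} → s ≤ t → DimAtLeast allL S t → DimAtLeast allL S s
  shrink s≤t (f , Sf , f-ind) =
    (λ j → f (inject≤ j s≤t)) , (λ j → Sf (inject≤ j s≤t)) , inject≤-independent allL s≤t tt f-ind

  -- Translation between dimension bounds and echelon rank.

  module _ {n} {S : Vec n → Set ℓ} (S-sub : IsSubspace S) (E : Echelon S) where
    open Echelon E

    atMost-rank : DimAtMost allL S (ℤ.+ rank)
    atMost-rank s f Sf = Span-atMost basis s f (∈Span-basis S-sub ∘ Sf)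

    atLeast⇒≤rank : ∀ {s} → DimAtLeast allL S s → s ≤ rank
    atLeast⇒≤rank (f , Sf , f-ind) = ℤ.drop‿+≤+ (atMost-rank _ f Sf f-ind)

    ≤rank⇒atLeast : ∀ {s} → s ≤ rank → DimAtLeast allL S s
    ≤rank⇒atLeast s≤rank = shrink {S = S} s≤rank (basis , basis∈ , basis-independent)

    atMost⇒rank≤ : ∀ {t} → DimAtMost allL S (ℤ.+ t) → rank ≤ t
    atMost⇒rank≤ S≤t = ℤ.drop‿+≤+ (S≤t rank basis basis∈ basis-independent)

    -- Full rank leaves no free coordinate, so the basis combination with the pivot entries of `v`
    -- agrees with `v` everywhere.
    full-rank⇒everything : n ≤ rank → ∀ v → S v
    full-rank⇒everything n≤rank v = resp (λ i → sym (v≐ (cover i))) (lincomb∈ (v ∘ pivot) basis∈)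
      where
      open IsSubspace S-sub
      no-free : ∀ {m} → rank ℕ.+ m ≡ n → ¬ Fin m
      no-free {suc m} eq _ = ℕ.<⇒≱ (subst (rank <_) eq (ℕ.m<m+n rank (s≤s z≤n))) n≤rank
      v≐ : ∀ {i} → (∃ λ j → pivot j ≡ i) ⊎ (∃ λ c → free c ≡ i) → v i ≡ lincomb (v ∘ pivot) basis i
      v≐ (inj₁ (j , refl)) = sym (lincomb-pivot _ j)
      v≐ (inj₂ (c , _))    = ⊥-elim (no-free rank+corank c)

  -- y ∈ Ker (columns M) means y M = 0, and y is determined by its entries at the pivots of that
  -- kernel together with the entries of y M at the free coordinates of Ker M.
  rank-nullity : ∀ {k b} (M : Matrix k b) (El : Echelon (Ker (columns M))) (Er : Echelon (Ker M)) →
    k ℕ.+ Echelon.rank Er ≤ Echelon.rank El ℕ.+ b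
  rank-nullity {k} {b} M El Er = begin
    k ℕ.+ R.rank                          ≤⟨ ℕ.+-monoˡ-≤ R.rank (linear-injection⇒≤ F F-⊖ F-ker) ⟩
    El.rank ℕ.+ R.corank ℕ.+ R.rank       ≡⟨ ℕ.+-assoc El.rank R.corank R.rank ⟩
    El.rank ℕ.+ (R.corank ℕ.+ R.rank)     ≡⟨ cong (El.rank ℕ.+_) (trans (ℕ.+-comm R.corank R.rank) R.rank+corank) ⟩
    El.rank ℕ.+ b                         ∎
    where
    open ℕ.≤-Reasoning
    module El = Echelon El
    module R = Echelon Er
    F : Vec k → Vec (El.rank ℕ.+ R.corank)
    F y = (y ∘ El.pivot) ++ (lincomb y M ∘ R.free)
    F-⊖ : ∀ x y → F (x ⊖ y) ≐ (F x ⊖ F y)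
    F-⊖ x y i with splitAt El.rank i
    ... | inj₁ j = refl
    ... | inj₂ c = lincomb-⊖ x y M (R.free c)
    F-ker : ∀ y → F y ≐ zeroVec → y ≐ zeroVec
    F-ker y Fy≐0 = El.determined y (λ j → trans (dot-comm (columns M j) y) (yM≐0 j)) (proj₁ split)
      where
      zero++zero : zeroVec {El.rank ℕ.+ R.corank} ≐ (zeroVec {El.rank} ++ zeroVec {R.corank})
      zero++zero i with splitAt El.rank i
      ... | inj₁ _ = refl
      ... | inj₂ _ = refl
      split = ++-injective (y ∘ El.pivot) zeroVec (λ i → trans (Fy≐0 i) (zero++zero i))
      yM = lincomb y M
      -- `yM` vanishes at the free coordinates and basis vector `l` at every other pivot, so their
      -- pairing reduces to one entry of `yM`; the pairing is zero because that basis vector lies in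
      -- `Ker M`.
      isolate : ∀ l j → ¬ j ≡ R.pivot l → yM j * R.basis l j ≡ 0#
      isolate l j j≢p with R.cover j
      ... | inj₁ (l′ , refl) = trans (cong (yM _ *_) (R.off l l′ (j≢p ∘ cong R.pivot))) (zeroʳ _)
      ... | inj₂ (c , refl)  = trans (cong (_* R.basis l _) (proj₂ split c)) (zeroˡ _)
      yM≐0 : yM ≐ zeroVec
      yM≐0 j with R.cover j
      ... | inj₂ (c , refl) = proj₂ split c
      ... | inj₁ (l , refl) = ≡.begin
        yM (R.pivot l)                          ≡.≡⟨ *-identityʳ _ ⟨
        yM (R.pivot l) * 1#                     ≡.≡⟨ cong (yM (R.pivot l) *_) (R.unit l) ⟨
        yM (R.pivot l) * R.basis l (R.pivot l)  ≡.≡⟨ sumFin-single b (R.pivot l) _ (isolate l) ⟨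
        dot yM (R.basis l)                      ≡.≡⟨ dot-lincomb y M (R.basis l) ⟩
        dot y (λ i → dot (M i) (R.basis l))     ≡.≡⟨ dot-zeroʳ y (R.basis∈ l) ⟩
        0#                                      ≡.∎
        where module ≡ = ≡-Reasoning

  -- Ranks of kernels, decidable independence and coefficient families.

  echelon-Ker : ∀ {t n} (M : Matrix t n) → Echelon (Ker M)
  echelon-Ker M = echelon (Ker-subspace M) (Ker? M)

  -- Rank-nullity for the transpose, where `columns (columns M)` computes to `M`.
  Ker-rank-lower : ∀ {t n} (M : Matrix t n) → n ≤ Echelon.rank (echelon-Ker M) ℕ.+ t
  Ker-rank-lower M = ℕ.≤-trans (ℕ.m≤m+n _ _) (rank-nullity (columns M) (echelon-Ker M) (echelon-Ker (columns M)))

  echelon-Span : ∀ {t n} (f : Fin t → Vec n) → Echelon (Span allL f)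
  echelon-Span f = echelon (Span-subspace f) (Span? f)

  -- `Ker (columns f)` is the space of relations among `f`, so independence becomes the decidable
  -- condition of rank 0.
  rank≤0⇒independent : ∀ {t n} {f : Fin t → Vec n} (E : Echelon (Ker (columns f))) →
    Echelon.rank E ≤ 0 → Independent allL f
  rank≤0⇒independent {f = f} E rank≤0 c _ cf≐0 = determined c
    (λ i → trans (dot-comm (columns f i) c) (cf≐0 i))
    (λ j → ⊥-elim (Fin.¬Fin0 (inject≤ j rank≤0)))
    where open Echelon E

  independent⇒rank≤0 : ∀ {t n} {f : Fin t → Vec n} (E : Echelon (Ker (columns f))) →
    Independent allL f → Echelon.rank E ≤ 0
  -- Each basis relation is zero and thus lies in the span of the empty family, which bounds the
  -- rank by 0.
  independent⇒rank≤0 {f = f} E f-ind = independent-in-Span⇒≤ {g = λ ()} (λ j → (λ ()) , (λ ()) ,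
    f-ind (basis j) _ (λ i → trans (dot-comm (basis j) (columns f i)) (basis∈ j i))) basis-independent
    where open Echelon E

  independent? : ∀ {t n} (f : Fin t → Vec n) → Dec (Independent allL f)
  independent? f = map′ (rank≤0⇒independent E) (independent⇒rank≤0 E) (Echelon.rank E ℕ.≤? 0)
    where E = echelon-Ker (columns f)

  Ker-rank-upper : ∀ {t n} (M : Matrix t n) → Independent allL M →
    t ℕ.+ Echelon.rank (echelon-Ker M) ≤ n
  Ker-rank-upper {n = n} M M-ind = ℕ.≤-trans
    (rank-nullity M (echelon-Ker (columns M)) (echelon-Ker M))
    (ℕ.+-monoˡ-≤ n (independent⇒rank≤0 (echelon-Ker (columns M)) M-ind))

  DimAtLeast-mono : ∀ {n d} {S T : Vec n → Set ℓ} → (∀ {v} → S v → T v) →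
    DimAtLeast allL S d → DimAtLeast allL T d
  DimAtLeast-mono S⊆T (f , Sf , f-ind) = f , S⊆T ∘ Sf , f-ind

  independent-lincomb : ∀ {n s t} {g : Fin t → Vec n} {z : Fin s → Vec t} →
    Independent allL g → Independent allL z → Independent allL (λ j → lincomb (z j) g)
  independent-lincomb {g = g} {z} g-ind z-ind c _ eq = z-ind c _
    (g-ind (lincomb c z) _ (λ i → trans (lincomb-assoc c z g i) (eq i)))

  coefficients-independent : ∀ P {n s t} {f : Fin s → Vec n} {g : Fin t → Vec n} (z : Fin s → Vec t) →
    (∀ j → f j ≐ lincomb (z j) g) → Independent P f → Independent P z
  coefficients-independent P {f = f} {g} z f≐ f-ind c Pc cz≐0 = f-ind c Pc λ i → begin
    lincomb c f i                           ≡⟨ lincomb-cong {c = c} (λ _ → refl) f≐ i ⟩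
    lincomb c (λ j → lincomb (z j) g) i     ≡⟨ lincomb-assoc c z g i ⟨
    lincomb (lincomb c z) g i               ≡⟨ dot-zeroˡ (columns g i) cz≐0 ⟩
    0#                                      ∎
    where open ≡-Reasoning

  invertible⇒independent : ∀ {k} (M : Matrix k k) → IsInvertible M → Independent allL M
  invertible⇒independent M (M′ , MM′≡1 , _) c _ cM≐0 i =
    trans (sym (lincomb-inverse M M′ MM′≡1 c i)) (dot-zeroˡ (columns M′ i) cM≐0)

  Span⊥Ker : ∀ {t n} {Z : Fin t → Vec n} {u v} → Span allL Z u → Ker Z v → dot u v ≡ 0#
  Span⊥Ker {Z = Z} {u} {v} (c , _ , u≐) Zv = trans (dot-cong u≐ (λ _ → refl))
    (trans (dot-lincomb c Z v) (dot-zeroʳ c Zv))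

  Span-lincomb : ∀ {t n k} {w : Fin t → Vec n} (M : Matrix n k) {u} →
    Span allL w u → Span allL (λ j → lincomb (w j) M) (lincomb u M)
  Span-lincomb {w = w} M (d , _ , u≐) = d , _ , λ i →
    trans (lincomb-cong {f = M} u≐ (λ _ _ → refl) i) (lincomb-assoc d w M i)

  -- Turns lower bounds into the absence of a configuration. The converse is constructive because
  -- the rank of each given `A` can be compared with `t`.
  GRWAtLeast⇔¬GRWAtMost : ∀ q {n} (C : Vec n → Set ℓ) s t →
    GRWAtLeast q C s (suc t) ⇔ (¬ GRWAtMost q C s t)
  GRWAtLeast⇔¬GRWAtMost q C s t = mk⇔ to from
    where
    to : GRWAtLeast q C s (suc t) → ¬ GRWAtMost q C s t
    to C≥ (A , closed , A∩C≥s , A≤t) with C≥ A closed A∩C≥s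
    ... | f , f∈ , f-ind = ℕ.1+n≰n (ℤ.drop‿+≤+ (A≤t (suc t) f f∈ f-ind))
    from : ¬ GRWAtMost q C s t → GRWAtLeast q C s (suc t)
    from ¬C≤ A closed A∩C≥s with suc t ℕ.≤? Echelon.rank (echelon-Span (Subspace.gens A))
    ... | yes t<rank = ≤rank⇒atLeast (Span-subspace _) (echelon-Span (Subspace.gens A)) t<rank
    ... | no t≮rank  = ⊥-elim (¬C≤ (A , closed , A∩C≥s , λ u f f∈ f-ind → ℤ.≤-trans
            (atMost-rank (Span-subspace _) (echelon-Span (Subspace.gens A)) u f f∈ f-ind)
            (ℤ.+≤+ (ℕ.s≤s⁻¹ (ℕ.≰⇒> t≮rank)))))

m+n≤o⇒n≤o∸m : ∀ m {n o} → m ℕ.+ n ≤ o → n ≤ o ∸ m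
m+n≤o⇒n≤o∸m m {n} {o} m+n≤o = ℕ.m+n≤o⇒m≤o∸n n (subst (_≤ o) (ℕ.+-comm m n) m+n≤o)

-- Galois descent from L to F_q.

module Galois {ℓ : Level} {N : ℕ} (L : FiniteField ℓ N) (q : ℕ) (0<q : 0 < q)
  (pow-+ : ∀ x y → LinAlg.pow L (FiniteField._+_ L x y) q ≡ FiniteField._+_ L (LinAlg.pow L x q) (LinAlg.pow L y q))
  where
  open FieldProperties L
  open LinearAlgebra L

  Fixed : ∀ {n} → Vec n → Set ℓ
  Fixed v = ∀ i → Fq q (v i)

  FrobeniusClosed : ∀ {n} → (Vec n → Set ℓ) → Set ℓ
  FrobeniusClosed S = ∀ v → S v → S (frob q v)

  pow-0 : pow 0# q ≡ 0#
  pow-0 = go q 0<q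
    where
    go : ∀ n → 0 < n → pow 0# n ≡ 0#
    go (suc n) _ = zeroˡ _

  pow-1 : pow 1# q ≡ 1#
  pow-1 = go q
    where
    go : ∀ n → pow 1# n ≡ 1#
    go zero    = refl
    go (suc n) = trans (*-identityˡ _) (go n)

  pow-sumFin : ∀ t (f : Fin t → Carrier) → pow (sumFin t f) q ≡ sumFin t (λ i → pow (f i) q)
  pow-sumFin zero    f = pow-0
  pow-sumFin (suc t) f = trans (pow-+ _ _) (cong (pow (f Fin.zero) q +_) (pow-sumFin t (f ∘ Fin.suc)))

  pow-dot : ∀ {n} (u v : Vec n) → pow (dot u v) q ≡ dot (frob q u) (frob q v)
  pow-dot {n} u v = trans (pow-sumFin n _) (sumFin-cong n (λ i → pow-* (u i) (v i) q))

  frob-lincomb : ∀ {n t} (c : Fin t → Carrier) {f : Fin t → Vec n} → (∀ j → Fixed (f j)) →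
    frob q (lincomb c f) ≐ lincomb (frob q c) f
  frob-lincomb c {f} f-fixed i = trans (pow-dot c (columns f i)) (dot-cong (λ _ → refl) (λ j → f-fixed j i))

  lincomb-fixed : ∀ {n t} (c : Fin t → Carrier) {f : Fin t → Vec n} → Fixed c → (∀ j → Fixed (f j)) →
    Fixed (lincomb c f)
  lincomb-fixed c {f} c-fixed f-fixed i =
    trans (frob-lincomb c {f} f-fixed i) (dot-cong c-fixed (λ _ → refl))

  Span-frobenius : ∀ {n t} {f : Fin t → Vec n} → (∀ j → Fixed (f j)) → FrobeniusClosed (Span allL f)
  Span-frobenius f-fixed v (c , _ , v≐) = frob q c , _ , λ i →
    trans (cong (λ x → pow x q) (v≐ i)) (frob-lincomb c f-fixed i)

  Ker-frobenius : ∀ {n t} {M : Matrix t n} → (∀ j → Fixed (M j)) → FrobeniusClosed (Ker M)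
  Ker-frobenius {M = M} M-fixed v Mv i = begin
    dot (M i) (frob q v)           ≡⟨ dot-cong (M-fixed i) (λ _ → refl) ⟨
    dot (frob q (M i)) (frob q v)  ≡⟨ pow-dot (M i) v ⟨
    pow (dot (M i) v) q            ≡⟨ cong (λ x → pow x q) (Mv i) ⟩
    pow 0# q                       ≡⟨ pow-0 ⟩
    0#                             ∎
    where open ≡-Reasoning

  -- Frobenius fixes the pivot entries 0 and 1 of a reduced basis vector, and these determine it.
  basis-fixed : ∀ {n} {S : Vec n → Set ℓ} → IsSubspace S → FrobeniusClosed S →
    (E : Echelon S) → ∀ j → Fixed (Echelon.basis E j)
  basis-fixed S-sub closed E j = agree S-sub (closed _ (basis∈ j)) (basis∈ j) pivot-fixed
    where
    open Echelon E
    pivot-fixed : ∀ l → pow (basis j (pivot l)) q ≡ basis j (pivot l)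
    pivot-fixed l with l Fin.≟ j
    ... | yes refl rewrite unit j     = pow-1
    ... | no l≢j   rewrite off j l l≢j = pow-0

  -- The space of L-relations among `X` is Frobenius closed, so its reduced basis has entries in
  -- F_q. By hypothesis those basis relations are zero, and with them the whole space.
  fixed-independent : ∀ {n t} {X : Fin t → Vec n} → (∀ j → Fixed (X j)) →
    Independent (Fq q) X → Independent allL X
  fixed-independent {X = X} X-fixed X-ind c _ cX≐0 j =
    trans (expand K-sub (λ i → trans (dot-comm (columns X i) c) (cX≐0 i)) j)
      (dot-zeroʳ (c ∘ pivot) (λ l → basis≐0 l j))
    where
    K-sub = Ker-subspace (columns X)
    open Echelon (echelon-Ker (columns X))
    basis≐0 : ∀ l → basis l ≐ zeroVec
    basis≐0 l = X-ind (basis l)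
      (basis-fixed K-sub (Ker-frobenius (λ i j → X-fixed j i)) (echelon-Ker (columns X)) l)
      (λ i → trans (dot-comm (basis l) (columns X i)) (basis∈ l i))

  -- n independent vectors in the F_q-span of n generators force the generators to be independent:
  -- the coefficient matrix is invertible, so a relation z among the generators is x C with x over F_q.
  spanning-family-independent : ∀ {k n} (g : Fin n → Vec k) →
    DimAtLeast (Fq q) (Span (Fq q) g) n → Independent (Fq q) g
  spanning-family-independent {k} {n} g (f , f∈ , f-ind) z z-fixed zg≐0 i = begin
    z i            ≡⟨ proj₂ (proj₂ z∈) i ⟩
    lincomb x C i  ≡⟨ dot-zeroˡ (columns C i) x≐0 ⟩
    0#             ∎
    where
    open ≡-Reasoning
    C : Fin n → Vec n
    C j = proj₁ (f∈ j)
    C-fixed : ∀ j → Fixed (C j)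
    C-fixed j = proj₁ (proj₂ (f∈ j))
    f≐ : ∀ j → f j ≐ lincomb (C j) g
    f≐ j = proj₂ (proj₂ (f∈ j))
    C-ind : Independent allL C
    C-ind = fixed-independent C-fixed (coefficients-independent (Fq q) C f≐ f-ind)
    E = echelon-Span C
    z∈ : Span allL C z
    z∈ = full-rank⇒everything (Span-subspace C) E
      (atLeast⇒≤rank (Span-subspace C) E (C , gen∈Span C , C-ind)) z
    x = proj₁ z∈
    -- Frobenius fixes `z` and `C`, so z = x C remains true with `frob q x` for `x`; `C-ind` then
    -- identifies the two.
    x-fixed : Fixed x
    x-fixed j = x-y≡0⇒x≡y _ _ (C-ind (frob q x ⊖ x) _ (λ l → begin
      lincomb (frob q x ⊖ x) C l                   ≡⟨ lincomb-⊖ (frob q x) x C l ⟩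
      lincomb (frob q x) C l + - lincomb x C l     ≡⟨ cong (_+ - lincomb x C l) (frob-lincomb x C-fixed l) ⟨
      pow (lincomb x C l) q + - lincomb x C l      ≡⟨ cong (λ y → pow y q + - y) (proj₂ (proj₂ z∈) l) ⟨
      pow (z l) q + - z l                          ≡⟨ cong (_+ - z l) (z-fixed l) ⟩
      z l + - z l                                  ≡⟨ -‿inverseʳ (z l) ⟩
      0#                                           ∎) j)
    x≐0 : x ≐ zeroVec
    x≐0 = f-ind x x-fixed λ l → begin
      lincomb x f l                         ≡⟨ lincomb-cong {c = x} (λ _ → refl) f≐ l ⟩
      lincomb x (λ j → lincomb (C j) g) l   ≡⟨ lincomb-assoc x C g l ⟨
      lincomb (lincomb x C) g l             ≡⟨ lincomb-cong {f = g} (proj₂ (proj₂ z∈)) (λ _ _ → refl) l ⟨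
      lincomb z g l                         ≡⟨ zg≐0 l ⟩
      0#                                    ∎

  -- Rational witnesses for generalized rank weights and for evasiveness.

  module _ {k n} (G : Matrix k n) where

    -- The F_q-rational point x of L^n corresponds to the system vector G x.
    image : ∀ {b} → (Fin b → Vec n) → Fin b → Vec k
    image X j = lincomb (X j) (columns G)

    -- b rational vectors, independent over L, whose span is orthogonal to an s-dimensional subcode.
    IsWitness : ∀ {b} → ℕ → (Fin b → Vec n) → Set ℓ
    IsWitness s X = (∀ j → Fixed (X j)) × Independent allL X × DimAtLeast allL (Ker (image X)) s

    Witness : ℕ → ℕ → Set ℓ
    Witness b s = Σ (Fin b → Vec n) (IsWitness s)

    -- Deciding existence is what later recovers a witness from a mere failure of evasiveness.
    witness? : ∀ b s → Dec (Witness b s)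
    witness? b s = searchFun {_≈_ = _≐_} (λ _ → refl) (searchVec n) b (IsWitness s) IsWitness-resp λ X →
      Fin.all? (λ j → Fin.all? (λ i → pow (X j i) q ≟ₗ X j i))
        ×-dec independent? X
        ×-dec map′ (≤rank⇒atLeast (Ker-subspace (image X)) (echelon-Ker (image X)))
          (atLeast⇒≤rank (Ker-subspace (image X)) (echelon-Ker (image X))) (s ℕ.≤? _)
      where
      IsWitness-resp : {X Y : Fin b → Vec n} → (∀ j → X j ≐ Y j) → IsWitness s X → IsWitness s Y
      IsWitness-resp {X} X≐Y (X-fixed , X-ind , X-dim) =
        (λ j i → subst (Fq q) (X≐Y j i) (X-fixed j i)) ,
        (λ c _ cY≐0 → X-ind c _ (λ i → trans (lincomb-cong {c = c} (λ _ → refl) X≐Y i) (cY≐0 i))) ,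
        DimAtLeast-mono {S = Ker (image X)}
          (λ {v} Xv j → trans (dot-cong {v = v} (lincomb-cong {f = columns G} (λ i → sym (X≐Y j i)) (λ _ _ → refl))
            (λ _ → refl)) (Xv j)) X-dim

    -- Descent twice: the reduced basis of `A` is rational, so the orthogonal of `A` is Frobenius
    -- closed and has a rational reduced basis. That basis has at least n - a members, of which `b`
    -- are kept.
    fixed-complement : (A : Subspace n) → GaloisClosed q A → ∀ {a} → DimAtMost allL (mem A) (ℤ.+ a) →
      ∀ {b} → b ℕ.+ a ≤ n →
      Σ (Fin b → Vec n) λ X → (∀ j → Fixed (X j)) × Independent allL X × (∀ {v} → mem A v → Ker X v)
    fixed-complement A closed {a} A≤a {b} b+a≤n =
      (λ j → K.basis (inject≤ j b≤d)) ,
      (λ j → basis-fixed K-sub (Ker-frobenius Z-fixed) EK (inject≤ j b≤d)) ,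
      inject≤-independent allL b≤d tt K.basis-independent ,
      λ {v} v∈ j → trans (dot-comm _ v) (Span⊥Ker (Z.∈Span-basis A-sub v∈) (K.basis∈ (inject≤ j b≤d)))
      where
      A-sub = Span-subspace (Subspace.gens A)
      EZ = echelon-Span (Subspace.gens A)
      module Z = Echelon EZ
      Z-fixed = basis-fixed A-sub closed EZ
      K-sub = Ker-subspace Z.basis
      EK = echelon-Ker Z.basis
      module K = Echelon EK
      b≤d : b ≤ K.rank
      b≤d = ℕ.+-cancelʳ-≤ a b K.rank (ℕ.≤-trans b+a≤n (ℕ.≤-trans (Ker-rank-lower Z.basis)
        (ℕ.+-monoʳ-≤ K.rank (atMost⇒rank≤ A-sub EZ A≤a))))

    -- Orthogonality exchanges `A` and the span of `X`, and `dot-columns` matches codewords y G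
    -- orthogonal to `X` with vectors y orthogonal to `image X`.
    code-GRWAtMost⇔Witness : IsGeneratorMatrix G → ∀ b s → b ≤ n →
      GRWAtMost q (Code G) s (n ∸ b) ⇔ Witness b s
    code-GRWAtMost⇔Witness G-ind b s b≤n = mk⇔ to from
      where
      open ≡-Reasoning
      to : GRWAtMost q (Code G) s (n ∸ b) → Witness b s
      to (A , closed , (f , f∈ , f-ind) , A≤) =
        X , X-fixed , X-ind , y , y∈ , coefficients-independent allL y f≐ f-ind
        where
        complement = fixed-complement A closed A≤ (ℕ.≤-reflexive (ℕ.m+[n∸m]≡n b≤n))
        X = proj₁ complement
        X-fixed = proj₁ (proj₂ complement)
        X-ind = proj₁ (proj₂ (proj₂ complement))
        A⊥X : ∀ {v} → mem A v → Ker X v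
        A⊥X = proj₂ (proj₂ (proj₂ complement))
        y : Fin s → Vec k
        y j = proj₁ (proj₂ (f∈ j))
        f≐ : ∀ j → f j ≐ lincomb (y j) G
        f≐ j = proj₂ (proj₂ (proj₂ (f∈ j)))
        y∈ : ∀ j → Ker (image X) (y j)
        y∈ j i = begin
          dot (image X i) (y j)          ≡⟨ dot-columns G (X i) (y j) ⟩
          dot (lincomb (y j) G) (X i)    ≡⟨ dot-cong (f≐ j) (λ _ → refl) ⟨
          dot (f j) (X i)                ≡⟨ dot-comm (f j) (X i) ⟩
          dot (X i) (f j)                ≡⟨ A⊥X (proj₁ (f∈ j)) i ⟩
          0#                             ∎
      from : Witness b s → GRWAtMost q (Code G) s (n ∸ b)
      from (X , X-fixed , X-ind , y , y∈ , y-ind) =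
        subspace rank basis ,
        Span-frobenius (basis-fixed X-sub (Ker-frobenius X-fixed) E) ,
        ((λ j → lincomb (y j) G) , (λ j → ∈Span-basis X-sub (λ i → orthogonal i j) , y j , _ , λ _ → refl) ,
          independent-lincomb G-ind y-ind) ,
        λ t f f∈ f-ind → ℤ.≤-trans (Span-atMost basis t f f∈ f-ind)
          (ℤ.+≤+ (m+n≤o⇒n≤o∸m b (Ker-rank-upper X X-ind)))
        where
        X-sub = Ker-subspace X
        E = echelon-Ker X
        open Echelon E
        orthogonal : ∀ i j → dot (X i) (lincomb (y j) G) ≡ 0#
        orthogonal i j = trans (dot-comm (X i) _) (trans (sym (dot-columns G (X i) (y j))) (y∈ j i))

    -- The index equation comes from rank-nullity for the b × k matrix `image X`: relations among
    -- its rows give combinations of `X` in the dual code, and its kernel gives the subcode. The two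
    -- directions use the inequality for the matrix and for its transpose.
    dual-GRWAtMost⇔Witness : ∀ b s s′ → b ≤ n → s′ ℕ.+ k ≡ b ℕ.+ s →
      GRWAtMost q (Dual (Code G)) s′ b ⇔ Witness b s
    dual-GRWAtMost⇔Witness b s s′ b≤n s′+k≡b+s = mk⇔ to from
      where
      image-lincomb : ∀ {b} (X : Fin b → Vec n) z i → lincomb z (image X) i ≡ dot (lincomb z X) (G i)
      image-lincomb X z i = sym (dot-lincomb z X (G i))
      to : GRWAtMost q (Dual (Code G)) s′ b → Witness b s
      to (B , closed , (f , f∈ , f-ind) , B≤) = subst (λ b → Witness b s) rank≡b
        ( basis , basis-fixed Z-sub (Ker-frobenius Z-fixed) E , basis-independent
        , ≤rank⇒atLeast (Ker-subspace (image basis)) EM s≤rank )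
        where
        -- `B` may have dimension below `b`. The orthogonal of n ∸ b rational vectors orthogonal to
        -- `B` enlarges it to a rational space of dimension exactly `b`.
        complement = fixed-complement B closed B≤ (ℕ.≤-reflexive (ℕ.m∸n+n≡m b≤n))
        Z = proj₁ complement
        Z-fixed = proj₁ (proj₂ complement)
        Z-ind = proj₁ (proj₂ (proj₂ complement))
        B⊥Z : ∀ {v} → mem B v → Ker Z v
        B⊥Z = proj₂ (proj₂ (proj₂ complement))
        Z-sub = Ker-subspace Z
        E = echelon-Ker Z
        open Echelon E
        rank≡b : rank ≡ b
        rank≡b = ℕ.≤-antisym
          (ℕ.≤-trans (m+n≤o⇒n≤o∸m (n ∸ b) (Ker-rank-upper Z Z-ind)) (ℕ.≤-reflexive (ℕ.m∸[m∸n]≡n b≤n)))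
          (ℕ.+-cancelʳ-≤ (n ∸ b) b rank (ℕ.≤-trans (ℕ.≤-reflexive (ℕ.m+[n∸m]≡n b≤n)) (Ker-rank-lower Z)))
        f∈Span : ∀ j → Span allL basis (f j)
        f∈Span j = ∈Span-basis Z-sub (B⊥Z (proj₁ (f∈ j)))
        z : Fin s′ → Vec rank
        z j = proj₁ (f∈Span j)
        f≐ : ∀ j → f j ≐ lincomb (z j) basis
        f≐ j = proj₂ (proj₂ (f∈Span j))
        EM = echelon-Ker (image basis)
        ET = echelon-Ker (columns (image basis))
        z∈ : ∀ j → Ker (columns (image basis)) (z j)
        z∈ j i = begin
          dot (columns (image basis) i) (z j)   ≡⟨ dot-comm (columns (image basis) i) (z j) ⟩
          lincomb (z j) (image basis) i         ≡⟨ image-lincomb basis (z j) i ⟩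
          dot (lincomb (z j) basis) (G i)       ≡⟨ dot-cong (f≐ j) (λ _ → refl) ⟨
          dot (f j) (G i)                       ≡⟨ dot-comm (f j) (G i) ⟩
          dot (G i) (f j)                       ≡⟨ proj₂ (f∈ j) (G i) (gen∈Span G i) ⟩
          0#                                    ∎
          where open ≡-Reasoning
        s≤rank : s ≤ Echelon.rank EM
        s≤rank = ℕ.+-cancelˡ-≤ b s (Echelon.rank EM) (begin
          b ℕ.+ s                        ≡⟨ s′+k≡b+s ⟨
          s′ ℕ.+ k                       ≡⟨ ℕ.+-comm s′ k ⟩
          k ℕ.+ s′                       ≤⟨ ℕ.+-monoʳ-≤ k (atLeast⇒≤rank (Ker-subspace _) ET
                                              (z , z∈ , coefficients-independent allL z f≐ f-ind)) ⟩
          k ℕ.+ Echelon.rank ET          ≤⟨ rank-nullity (columns (image basis)) EM ET ⟩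
          Echelon.rank EM ℕ.+ rank       ≡⟨ ℕ.+-comm (Echelon.rank EM) rank ⟩
          rank ℕ.+ Echelon.rank EM       ≡⟨ cong (ℕ._+ Echelon.rank EM) rank≡b ⟩
          b ℕ.+ Echelon.rank EM          ∎)
          where open ℕ.≤-Reasoning
      from : Witness b s → GRWAtMost q (Dual (Code G)) s′ b
      from (X , X-fixed , X-ind , X-dim) =
        subspace b X , Span-frobenius X-fixed ,
        ((λ j → lincomb (z j) X) , (λ j → (z j , _ , λ _ → refl) , orthogonal j) , independent-lincomb X-ind z-ind) ,
        Span-atMost X
        where
        EM = echelon-Ker (image X)
        ET = echelon-Ker (columns (image X))
        s′≤rank : s′ ≤ Echelon.rank ET
        s′≤rank = ℕ.+-cancelʳ-≤ k s′ (Echelon.rank ET) (begin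
          s′ ℕ.+ k                       ≡⟨ s′+k≡b+s ⟩
          b ℕ.+ s                        ≤⟨ ℕ.+-monoʳ-≤ b (atLeast⇒≤rank (Ker-subspace (image X)) EM X-dim) ⟩
          b ℕ.+ Echelon.rank EM          ≤⟨ rank-nullity (image X) ET EM ⟩
          Echelon.rank ET ℕ.+ k          ∎)
          where open ℕ.≤-Reasoning
        relations = ≤rank⇒atLeast (Ker-subspace (columns (image X))) ET s′≤rank
        z = proj₁ relations
        z∈ : ∀ j → Ker (columns (image X)) (z j)
        z∈ = proj₁ (proj₂ relations)
        z-ind = proj₂ (proj₂ relations)
        open ≡-Reasoning
        orthogonal : ∀ j → Dual (Code G) (lincomb (z j) X)
        orthogonal j c c∈ = Span⊥Ker c∈ λ i → begin
          dot (G i) (lincomb (z j) X)         ≡⟨ dot-comm (G i) _ ⟩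
          dot (lincomb (z j) X) (G i)         ≡⟨ image-lincomb X (z j) i ⟨
          lincomb (z j) (image X) i           ≡⟨ dot-comm (z j) (columns (image X) i) ⟩
          dot (columns (image X) i) (z j)     ≡⟨ z∈ j i ⟩
          0#                                  ∎

    -- The bound b - 1 is taken in the integers, so `b = 0` gives -1: evasiveness then fails, and
    -- the empty family is a witness.
    evasive⇔¬Witness : Nondegenerate q G → (M : Matrix k k) → IsInvertible M → ∀ h b → h ≤ k →
      Evasive q (System q G M) h (ℤ.+ b ℤ.- ℤ.+ 1) ⇔ (¬ Witness b (k ∸ h))
    evasive⇔¬Witness (columns-dim , _) M M-inv@(M′ , MM′≡1 , M′M≡1) h b h≤k = mk⇔ to from
      where
      M-ind = invertible⇒independent M M-inv
      to : Evasive q (System q G M) h (ℤ.+ b ℤ.- ℤ.+ 1) → ¬ Witness b (k ∸ h)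
      to evasive (X , X-fixed , X-ind , y , y∈ , y-ind) = b≰b-1 b
        -- The test space is the orthogonal of the `y`, moved by `M`; its dimension is exactly `h`
        -- because the `y` are k ∸ h independent vectors.
        (evasive (subspace rank gens)
          (shrink {S = Span allL gens} h≤rank (gens , gen∈Span gens , independent-lincomb M-ind basis-independent))
          (λ t f f∈ f-ind → ℤ.≤-trans (Span-atMost gens t f f∈ f-ind) (ℤ.+≤+ rank≤h))
          b u u∈ u-ind)
        where
        b≰b-1 : ∀ b → ¬ (ℤ.+ b ℤ.≤ ℤ.+ b ℤ.- ℤ.+ 1)
        b≰b-1 zero    ()
        b≰b-1 (suc b) (ℤ.+≤+ b<b) = ℕ.1+n≰n b<b
        y-sub = Ker-subspace y
        E = echelon-Ker y
        open Echelon E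
        rank≤h : rank ≤ h
        rank≤h = ℕ.≤-trans (m+n≤o⇒n≤o∸m (k ∸ h) (Ker-rank-upper y y-ind)) (ℕ.≤-reflexive (ℕ.m∸[m∸n]≡n h≤k))
        h≤rank : h ≤ rank
        h≤rank = ℕ.+-cancelʳ-≤ (k ∸ h) h rank (ℕ.≤-trans (ℕ.≤-reflexive (ℕ.m+[n∸m]≡n h≤k)) (Ker-rank-lower y))
        gens : Fin rank → Vec k
        gens j = lincomb (basis j) M
        u : Fin b → Vec k
        u j = lincomb (image X j) M
        u∈ : ∀ j → (System q G M ∩ Span allL gens) (u j)
        u∈ j = (image X j , (X j , X-fixed j , λ _ → refl) , λ _ → refl) ,
          Span-lincomb M (∈Span-basis y-sub (λ l → trans (dot-comm (y l) (image X j)) (y∈ l j)))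
        u-ind : Independent (Fq q) u
        -- A relation is stripped of `M` by invertibility, of the columns of `G` by nondegeneracy,
        -- which applies since `lincomb c X` has entries in F_q, and of `X` by independence.
        u-ind c c-fixed cu≐0 = X-ind c _ (spanning-family-independent (columns G) columns-dim (lincomb c X)
          (lincomb-fixed c c-fixed X-fixed)
          (λ i → trans (lincomb-assoc c X (columns G) i)
            (M-ind (lincomb c (image X)) _ (λ l → trans (lincomb-assoc c (image X) M l) (cu≐0 l)) i)))

      from : ¬ Witness b (k ∸ h) → Evasive q (System q G M) h (ℤ.+ b ℤ.- ℤ.+ 1)
      from ¬witness W _ W≤h t f f∈ f-ind with t ℕ.<? b
      ... | yes t<b = t≤b-1 t<b
        where
        t≤b-1 : ∀ {t b} → t < b → ℤ.+ t ℤ.≤ ℤ.+ b ℤ.- ℤ.+ 1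
        t≤b-1 (s≤s t≤b) = ℤ.+≤+ t≤b
      -- With at least `b` independent vectors in the intersection, the first `b` supply a witness.
      ... | no t≮b = ⊥-elim (¬witness
        ( (λ j → X (inject≤ j b≤t)) , (λ j → X-fixed (inject≤ j b≤t))
        , inject≤-independent allL b≤t tt (fixed-independent X-fixed X-ind)
        , DimAtLeast-mono {S = Ker W′}
            (λ {y} Ky j → trans (dot-cong {v = y} (λ i → sym (v≐ (inject≤ j b≤t) i)) (λ _ → refl))
              (Span⊥Ker {Z = W′} (v∈ (inject≤ j b≤t)) Ky))
            (≤rank⇒atLeast (Ker-subspace W′) (echelon-Ker W′) k-h≤rank) ))
        where
        b≤t = ℕ.≮⇒≥ t≮b
        W-sub = Span-subspace (Subspace.gens W)
        EW = echelon-Span (Subspace.gens W)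
        module W = Echelon EW
        v X : Fin t → Vec _
        v j = proj₁ (proj₁ (f∈ j))
        X j = proj₁ (proj₁ (proj₂ (proj₁ (f∈ j))))
        X-fixed : ∀ j → Fixed (X j)
        X-fixed j = proj₁ (proj₂ (proj₁ (proj₂ (proj₁ (f∈ j)))))
        v≐ : ∀ j → v j ≐ image X j
        v≐ j = proj₂ (proj₂ (proj₁ (proj₂ (proj₁ (f∈ j)))))
        f≐ : ∀ j → f j ≐ lincomb (v j) M
        f≐ j = proj₂ (proj₂ (proj₁ (f∈ j)))
        X-ind : Independent (Fq q) X
        X-ind = coefficients-independent (Fq q) {g = λ i → lincomb (columns G i) M} X
          (λ j i → trans (f≐ j i) (trans (lincomb-cong {f = M} (v≐ j) (λ _ _ → refl) i)
            (lincomb-assoc (X j) (columns G) M i))) f-ind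
        -- `M′` undoes the change of coordinates, so the span of this family contains the `v j`. Its
        -- dimension is at most `h`, which leaves an orthogonal of dimension at least k ∸ h.
        W′ : Fin W.rank → Vec k
        W′ i = lincomb (W.basis i) M′
        v∈ : ∀ j → Span allL W′ (v j)
        v∈ j = IsSubspace.resp (Span-subspace W′)
          (λ i → trans (lincomb-cong {f = M′} (f≐ j) (λ _ _ → refl) i) (lincomb-inverse M M′ MM′≡1 (v j) i))
          (Span-lincomb M′ (W.∈Span-basis W-sub (proj₂ (f∈ j))))
        k-h≤rank : k ∸ h ≤ Echelon.rank (echelon-Ker W′)
        k-h≤rank = ℕ.m≤n+o⇒m∸n≤o k h (ℕ.≤-trans (Ker-rank-lower W′)
          (ℕ.≤-trans (ℕ.+-monoʳ-≤ _ (atMost⇒rank≤ W-sub EW W≤h)) (ℕ.≤-reflexive (ℕ.+-comm _ h))))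

-- Deduction of the equivalences from witnesses with b = r and b = r + 1.

open import Data.Nat using (_+_)
open import Data.Integer using (+_) renaming (_-_ to _-ℤ_)
open LinAlg using (Matrix; IsGeneratorMatrix; Nondegenerate; IsInvertible; Evasive; System;
  GRWAtLeast; GRWAtMost; GRWEq; Code; Dual)

theorem3p3 : ∀ {ℓ : Level} (q m k n : ℕ) → IsPrimePower q → 1 ≤ m → 1 ≤ k → k ≤ n →
    (L : FiniteField ℓ (q ^ m)) →
    (G : Matrix L k n) → IsGeneratorMatrix L G → Nondegenerate L q G →
    (M : Matrix L k k) → IsInvertible L M →
    (h r : ℕ) → h < k → h ≤ r → r + 1 ≤ (n + h) ∸ k →
    ((Evasive L q (System L q G M) h (+ r) ⇔ GRWAtLeast L q (Code L G) (k ∸ h) (n ∸ r))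
    × (GRWAtLeast L q (Code L G) (k ∸ h) (n ∸ r)
    ⇔ GRWAtLeast L q (Dual L (Code L G)) ((r ∸ h) + 1) (r + 2)))
    × ((GRWEq L q (Code L G) (k ∸ h) (n ∸ r)
    ⇔ (Evasive L q (System L q G M) h (+ r)
    × ¬ Evasive L q (System L q G M) h (+ r -ℤ + 1)))
    × (GRWEq L q (Code L G) (k ∸ h) (n ∸ r)
    ⇔ (GRWAtLeast L q (Dual L (Code L G)) ((r ∸ h) + 1) (r + 2)
    × GRWAtMost L q (Dual L (Code L G)) (r ∸ h) r)))
theorem3p3 {ℓ} q m k n q-prime-power _ _ _ L G G-ind G-nondeg M M-inv h r h<k h≤r r+1≤n+h∸k =
  -- Evasiveness and both lower bounds amount to `¬ Hit (r + 1)`; failure of (h, r - 1)-evasiveness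
  -- and both upper bounds amount to `Hit r`.
  (⇔-sym code≥⇔ ⇔-∘ evasive⇔ , ⇔-sym dual≥⇔ ⇔-∘ code≥⇔) ,
  ((⇔-sym evasive⇔ ⇔-∘ code≥⇔) ×-⇔ (⇔-sym ¬evasive⇔ ⇔-∘ code≤⇔)) ,
  ((⇔-sym dual≥⇔ ⇔-∘ code≥⇔) ×-⇔ (⇔-sym dual≤⇔ ⇔-∘ code≤⇔))
  where
  0<q : ∀ {q} → IsPrimePower q → 0 < q
  0<q (p , e , isPrime , _ , refl) = ℕ.m^n>0 p {{prime⇒nonZero isPrime}} e

  open Galois L q (0<q q-prime-power) (FieldProperties.frobenius-+ L q m q-prime-power refl)
  open LinearAlgebra L using (GRWAtLeast⇔¬GRWAtMost)

  h≤k : h ≤ k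
  h≤k = ℕ.<⇒≤ h<k

  r+1≤n : r + 1 ≤ n
  r+1≤n = ℕ.≤-trans r+1≤n+h∸k (ℕ.m≤n+o⇒m∸n≤o (n + h) k
    (ℕ.≤-trans (ℕ.+-monoʳ-≤ n h≤k) (ℕ.≤-reflexive (ℕ.+-comm n k))))

  r≤n : r ≤ n
  r≤n = ℕ.≤-trans (ℕ.m≤m+n r 1) r+1≤n

  Hit : ℕ → Set ℓ
  Hit b = Witness G b (k ∸ h)

  evasive⇔ : Evasive L q (System L q G M) h (+ r) ⇔ (¬ Hit (r + 1))
  evasive⇔ = subst (λ i → Evasive L q (System L q G M) h i ⇔ (¬ Hit (r + 1))) (pred-suc r)
    (evasive⇔¬Witness G G-nondeg M M-inv h (r + 1) h≤k)
    where
    pred-suc : ∀ r → + (r + 1) -ℤ + 1 ≡ + r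
    pred-suc r rewrite ℕ.+-comm r 1 = refl

  ¬evasive⇔ : (¬ Evasive L q (System L q G M) h (+ r -ℤ + 1)) ⇔ Hit r
  ¬evasive⇔ = mk⇔
    -- Failure of evasiveness only refutes the absence of a witness; decidability then supplies one.
    (λ ¬evasive → decidable-stable (witness? G r (k ∸ h)) (¬evasive ∘ Equivalence.from evasive⇔¬Hit))
    (λ hit evasive → Equivalence.to evasive⇔¬Hit evasive hit)
    where evasive⇔¬Hit = evasive⇔¬Witness G G-nondeg M M-inv h r h≤k

  code≤⇔ : GRWAtMost L q (Code L G) (k ∸ h) (n ∸ r) ⇔ Hit r
  code≤⇔ = code-GRWAtMost⇔Witness G G-ind r (k ∸ h) r≤n

  -- A weight of at least n - r excludes one of at most n - r - 1, whose witnesses have r + 1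
  -- vectors. By `r+1≤n` the truncated subtractions are exact.
  code≥⇔ : GRWAtLeast L q (Code L G) (k ∸ h) (n ∸ r) ⇔ (¬ Hit (r + 1))
  code≥⇔ = subst (λ t → GRWAtLeast L q (Code L G) (k ∸ h) t ⇔ (¬ Hit (r + 1))) suc[n∸[r+1]]≡n∸r
    (¬-cong-⇔ (code-GRWAtMost⇔Witness G G-ind (r + 1) (k ∸ h) r+1≤n)
      ⇔-∘ GRWAtLeast⇔¬GRWAtMost q (Code L G) (k ∸ h) (n ∸ (r + 1)))
    where
    suc[n∸[r+1]]≡n∸r : suc (n ∸ (r + 1)) ≡ n ∸ r
    suc[n∸[r+1]]≡n∸r = trans (sym (ℕ.+-∸-assoc 1 r+1≤n)) (cong (suc n ∸_) (ℕ.+-comm r 1))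

  -- The index equation of the dual criterion, used for b = r and b = r + 1.
  weights : ∀ {b} → h ≤ b → (b ∸ h) + k ≡ b + (k ∸ h)
  weights {b} h≤b = trans (sym (ℕ.+-∸-comm k h≤b)) (ℕ.+-∸-assoc b h≤k)

  dual≤⇔ : GRWAtMost L q (Dual L (Code L G)) (r ∸ h) r ⇔ Hit r
  dual≤⇔ = dual-GRWAtMost⇔Witness G r (k ∸ h) (r ∸ h) r≤n (weights h≤r)

  dual≥⇔ : GRWAtLeast L q (Dual L (Code L G)) ((r ∸ h) + 1) (r + 2) ⇔ (¬ Hit (r + 1))
  dual≥⇔ = subst (λ t → GRWAtLeast L q (Dual L (Code L G)) ((r ∸ h) + 1) t ⇔ (¬ Hit (r + 1))) (sym (ℕ.+-suc r 1))
    (¬-cong-⇔ (dual-GRWAtMost⇔Witness G (r + 1) (k ∸ h) ((r ∸ h) + 1) r+1≤n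
        (trans (cong (_+ k) (sym (ℕ.+-∸-comm 1 h≤r))) (weights (ℕ.≤-trans h≤r (ℕ.m≤m+n r 1)))))
      ⇔-∘ GRWAtLeast⇔¬GRWAtMost q (Dual L (Code L G)) ((r ∸ h) + 1) (r + 1))
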